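{- Let $k\ge3$ and let $\mathbf F$ be a $k$-CNF formula on $n$ variables. If $\mathbf F$ is satisfiable, the PPZ algorithm succeeds in finding a satisfying assignment of $\mathbf F$ within $$O^*\left(\frac{2^{n-n/k}}{N_{\lfloor 2n/k\rfloor}}\right)$$ iterations (with probability $1-o(1)$).
   Context: $\Omega_{\mathbf F}\subseteq\{0,1\}^n$ is the set of satisfying assignments of $\mathbf F$, $d_H$ is Hamming distance, $\mathrm{minPD}(S)=\min_{z_1\neq z_2\in S}d_H(z_1,z_2)$ (with $\mathrm{minPD}(S)=+\infty$ if $|S|=1$). For $r\in\{0,\dots,n\}$, $N_r=\max\{|S|: S\subseteq\Omega_{\mathbf F},\ \mathrm{minPD}(S)\ge r\}$. One iteration of the PPZ algorithm on $\mathbf F$: sample $y\in\{0,1\}^n$ and a permutation $\pi\in S_n$ uniformly and independently. Set $\mathbf F_0=\mathbf F$. For $i=1,\dots,n$: if $\mathbf F_{i-1}$ contains the unit clause $(x_{\pi(i)})$, set $u_{\pi(i)}=1$; otherwise, if it contains the unit clause $(\overline{x_{\pi(i)}})$, set $u_{\pi(i)}=0$; otherwise set $u_{\pi(i)}=y_{\pi(i)}$. Then let $\mathbf F_i$ be $\mathbf F_{i-1}$ with $x_{\pi(i)}$ replaced by $u_{\pi(i)}$ (satisfied clauses removed, false literals deleted). The iteration outputs $u$. The algorithm repeats independent iterations until the output satisfies $\mathbf F$. A $k$-CNF formula is a conjunction of clauses, each a disjunction of at most $k$ literals. $k$ is a constant and $O^*$ hides factors polynomial in $n$. -}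

module Defs where

open import Data.Bool.Base using (Bool; true; false; not; if_then_else_)
import Data.Bool.Properties as Bool
open import Data.Fin.Base using (Fin)
import Data.Fin.Properties as Fin
open import Data.Integer.Base using (+_)
open import Data.List.Base using
  (List; []; _∷_; _++_; map; filter; length; allFin; cartesianProduct; cartesianProductWith)
open import Data.List.Extrema.Nat using (min; max)
open import Data.List.Membership.Propositional using (_∈_)
open import Data.List.Relation.Unary.All as All using (All)
open import Data.List.Relation.Unary.Any as Any using (Any)
open import Data.Nat.Base using (ℕ; zero; suc; _*_; _∸_; _^_; _≤_)
import Data.Nat.Properties as ℕ
open import Data.Product.Base using (_×_; _,_; ∃; uncurry)
import Data.Product.Properties as Product
open import Data.Rational.Unnormalised.Base as ℚᵘ using (ℚᵘ; 0ℚᵘ)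
open import Data.Vec.Base as Vec using (Vec; []; _∷_; lookup; zip; count; _[_]≔_)
import Data.Vec.Properties as Vec
import Data.Vec.Relation.Unary.AllPairs as VecAllPairs
import Data.Vec.Relation.Unary.Any as VecAny
open import Data.Vec.Relation.Unary.Unique.Propositional as VecUnique using ()
open import Level using (Level)
open import Relation.Binary.Construct.Add.Supremum.NonStrict _≤_ using (_≤⁺_; ≤⁺-dec)
open import Relation.Binary.Definitions using (DecidableEquality)
open import Relation.Binary.PropositionalEquality.Core using (_≡_; _≢_)
open import Relation.Nullary.Construct.Add.Supremum using (_⁺; ⊤⁺; [_])
open import Relation.Nullary.Decidable using (Dec; does; ¬?; _×-dec_)
open import Relation.Unary using (Pred; Decidable)

private
  variable
    a p : Level
    A : Set a
    m n : ℕ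

vectors : List A → ∀ n → List (Vec A n)
vectors xs zero    = [] ∷ []
vectors xs (suc n) = cartesianProductWith _∷_ xs (vectors xs n)

sublists : List A → List (List A)
sublists []       = [] ∷ []
sublists (x ∷ xs) = map (x ∷_) (sublists xs) ++ sublists xs

Assignment : ℕ → Set
Assignment n = Vec Bool n

assignments : ∀ n → List (Assignment n)
assignments n = vectors (false ∷ true ∷ []) n

-- The literal (x , true) is the variable x, and (x , false) is its negation.
Literal : ℕ → Set
Literal n = Fin n × Bool

_≟ˡ_ : DecidableEquality (Literal n)
_≟ˡ_ = Product.≡-dec Fin._≟_ Bool._≟_

-- Clauses and formulas are lists read as sets: repetitions and order carry no
-- meaning (cf. IsUnit).
Clause : ℕ → Set
Clause n = List (Literal n)

CNF : ℕ → Set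
CNF n = List (Clause n)

IsKCNF : ℕ → CNF n → Set
IsKCNF k F = All (λ c → length c ≤ k) F

Makes-true : Assignment n → Literal n → Set
Makes-true z (x , b) = lookup z x ≡ b

_⊨_ : Assignment n → CNF n → Set
z ⊨ F = All (Any (Makes-true z)) F

_⊨?_ : (z : Assignment n) (F : CNF n) → Dec (z ⊨ F)
z ⊨? F = All.all? (Any.any? λ (x , b) → lookup z x Bool.≟ b) F

Satisfiable : CNF n → Set
Satisfiable F = ∃ λ z → z ⊨ F

Ω : CNF n → List (Assignment n)
Ω F = filter (_⊨? F) (assignments _)

d-H : Assignment n → Assignment n → ℕ
d-H z₁ z₂ = count (λ (b₁ , b₂) → ¬? (b₁ Bool.≟ b₂)) (zip z₁ z₂)

minimum : List ℕ → ℕ ⁺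
minimum []       = ⊤⁺
minimum (d ∷ ds) = [ min d ds ]

minPD : List (Assignment n) → ℕ ⁺
minPD S = minimum (map (uncurry d-H) (filter distinct? (cartesianProduct S S)))
  where
  distinct? : Decidable (uncurry _≢_)
  distinct? (z₁ , z₂) = ¬? (Vec.≡-dec Bool._≟_ z₁ z₂)

-- Ω F has no repetitions, so its sublists are its subsets, each listed once.
N : CNF n → ℕ → ℕ
N F r = max 0 (map length (filter separated? (sublists (Ω F))))
  where
  separated? : Decidable (λ S → [ r ] ≤⁺ minPD S)
  separated? S = ≤⁺-dec ℕ._≤?_ [ r ] (minPD S)

-- As a set, the clause c is {l}.
IsUnit : Literal n → Clause n → Set
IsUnit l c = l ∈ c × All (_≡ l) c

HasUnit : Literal n → CNF n → Set
HasUnit l F = Any (IsUnit l) F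

hasUnit? : (l : Literal n) (F : CNF n) → Dec (HasUnit l F)
hasUnit? l F =
  Any.any? (λ c → Any.any? (l ≟ˡ_) c ×-dec All.all? (_≟ˡ l) c) F

-- Satisfied clauses are removed, and false literals are deleted from the rest.
substitute : Fin n → Bool → CNF n → CNF n
substitute x b F =
  map (filter λ l → ¬? (l ≟ˡ (x , not b)))
      (filter (λ c → ¬? (Any.any? ((x , b) ≟ˡ_) c)) F)

ppzValue : CNF n → Assignment n → Fin n → Bool
ppzValue F y x =
  if does (hasUnit? (x , true) F) then true
  else if does (hasUnit? (x , false) F) then false
  else lookup y x

-- The base value y is arbitrary: when π is a permutation, every coordinate gets
-- overwritten.
ppz : CNF n → Assignment n → Vec (Fin n) m → Assignment n
ppz F y []      = y
ppz F y (x ∷ π) = ppz (substitute x u F) y π [ x ]≔ u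
  where u = ppzValue F y x

-- A permutation π is given as the tuple (π(1), …, π(n)) of its distinct values.
permutations : ∀ n → List (Vec (Fin n) n)
permutations n = filter unique? (vectors (allFin n) n)
  where
  unique? : Decidable VecUnique.Unique
  unique? = VecAllPairs.allPairs? (λ i j → ¬? (i Fin.≟ j))

Seed : ℕ → Set
Seed n = Assignment n × Vec (Fin n) n

seeds : ∀ n → List (Seed n)
seeds n = cartesianProduct (assignments n) (permutations n)

_/₀_ : ℕ → ℕ → ℚᵘ
m /₀ zero  = 0ℚᵘ
m /₀ suc n = + m ℚᵘ./ suc n

-- Probability under the uniform distribution on a repetition-free, nonempty list.
Pr : {P : Pred A p} → Decidable P → List A → ℚᵘ
Pr P? xs = length (filter P? xs) /₀ length xs

-- The uniform distribution on T-tuples of seeds is that of T independent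
-- iterations; the algorithm has stopped by then iff one of the outputs satisfies F.
successWithin : CNF n → ℕ → ℚᵘ
successWithin {n} F T = Pr success? (vectors (seeds n) T)
  where
  success? : Decidable (VecAny.Any (λ (y , π) → ppz F y π ⊨ F))
  success? = VecAny.any? (λ (y , π) → ppz F y π ⊨? F)

TendsToZero : (ℕ → ℚᵘ) → Set
TendsToZero ε =
  ∀ δ → 0ℚᵘ ℚᵘ.< δ → ∃ λ n₀ → ∀ n → n₀ ≤ n → ℚᵘ.∣ ε n ∣ ℚᵘ.< δ

-- T ≤ c nᵈ · 2^(n - n/k) / N, with N moved to the left and both sides raised to
-- the k-th power so as to stay in ℕ.  The subtraction is exact for k ≥ 1.
IterationBound : (k c d n N T : ℕ) → Set
IterationBound k c d n N T =
  (T * N) ^ k ≤ (c * n ^ d) ^ k * 2 ^ (k * n ∸ n)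

{-# OPTIONS --safe #-}

-- Let z be a solution and π an order of the variables.  If flipping z at i
-- falsifies a clause in which i comes last in π, then PPZ is forced to set i as
-- in z; with f such variables, 2^f of the 2^n base values y lead PPZ to z.  A
-- clause has at most k literals, so each i whose flip leaves the solution set is
-- forced for at least a 1/k fraction of the orders.
--
-- Let V_t be the number of solutions within distance t of a solution s.  As long
-- as V doubles from each radius to the next, V_t ≥ 2^t.  If it doubles up to the
-- packing radius ρ ≈ n/k, then the V_ρ ≥ 2^ρ ≈ 2^(n/k) solutions in the ball,
-- each produced by at least one y for every π, already have enough weight.
-- Otherwise V_(t+1) ≤ 2 V_t for some t ≤ ρ with V_t ≥ 2^t.  A solution in the
-- ball of radius t has at most t neighbours closer to s, and the edges leading
-- away from s are counted at their far ends, so the average number of solution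
-- neighbours is at most 3t+2.  Hence the average of f is at least
-- (n - 3t - 2)/k, and the ball has weight about 2^t · 2^((n-3t)/k) ≥ 2^(n/k),
-- since k ≥ 3.
--
-- Balls of radius ρ around points at distance 2n/k are disjoint, so one iteration
-- succeeds with probability at least about N · 2^(n/k) / 2^n.

module Submission where

open import Defs
open import Algebra.Properties.CommutativeSemigroup using (interchange)
open import Data.Bool.Base using (Bool; true; false; not; if_then_else_)
import Data.Bool.Properties as Bool
open import Data.Empty using (⊥)
open import Data.Fin.Base using (Fin; zero; suc)
open import Data.Fin.Permutation.Components using (transpose; transpose-inverse)
import Data.Fin.Properties as Fin
open import Data.Integer.Base as ℤ using (-[1+_])
import Data.Integer.Properties as ℤ
open import Data.List.Base
  using (List; []; _∷_; _++_; map; filter; length; allFin; cartesianProduct; cartesianProductWith)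
open import Data.List.Extrema.Nat using (min≤xs; min≤⊤; argmax-all)
open import Data.List.Membership.Propositional using (_∈_; find; lose)
open import Data.List.Membership.Propositional.Properties
  using ( ∈-filter⁺; ∈-filter⁻; ∈-map⁺; ∈-map⁻; ∈-map∘filter⁻; ∈-++⁻; ∈-allFin
        ; ∈-cartesianProduct⁺; ∈-cartesianProductWith⁺)
import Data.List.Properties as List
open import Data.List.Relation.Unary.All as All using (All; []; _∷_)
import Data.List.Relation.Unary.All.Properties as All
open import Data.List.Relation.Unary.AllPairs using ([]; _∷_)
open import Data.List.Relation.Unary.Any as Any using (Any; here; there)
open import Data.List.Relation.Unary.Unique.Propositional using (Unique)
import Data.List.Relation.Unary.Unique.Propositional.Properties as Unique
open import Data.Nat.Base
open import Data.Nat.DivMod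
open import Data.Nat.ListAction using (sum)
open import Data.Nat.Properties
open import Data.Nat.Tactic.RingSolver using (solve-∀)
open import Data.Product.Base using (_×_; _,_; proj₁; proj₂; uncurry; ∃-syntax; Σ-syntax)
open import Data.Rational.Unnormalised.Base as ℚᵘ using (ℚᵘ; 1ℚᵘ; mkℚᵘ; *≤*; *<*)
open import Data.Sum.Base as Sum using (_⊎_; inj₁; inj₂)
open import Data.Vec.Base as Vec using (Vec; []; _∷_; lookup; _[_]%=_)
import Data.Vec.Membership.DecPropositional as VecDec
import Data.Vec.Membership.Propositional as Vec
import Data.Vec.Membership.Propositional.Properties as Vec
import Data.Vec.Properties as Vec
import Data.Vec.Relation.Unary.All as VecAll
import Data.Vec.Relation.Unary.All.Properties as VecAll
import Data.Vec.Relation.Unary.AllPairs as VecAllPairs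
import Data.Vec.Relation.Unary.Any as VecAny
open import Data.Vec.Relation.Unary.Unique.Propositional as VecUnique using ()
import Data.Vec.Relation.Unary.Unique.Propositional.Properties as VecUnique
open import Function.Base using (_∘_; id)
open import Level using (Level)
open import Relation.Binary.Construct.Add.Supremum.NonStrict _≤_ using (_≤⁺_; [_])
open import Relation.Binary.Definitions using (DecidableEquality)
open import Relation.Binary.PropositionalEquality
open import Relation.Nullary.Construct.Add.Supremum using ([_])
open import Relation.Nullary.Decidable
  using (Dec; yes; no; does; _×-dec_; _⊎-dec_; ¬?; dec-true; decidable-stable)
open import Relation.Nullary.Negation using (¬_; contradiction)
open import Relation.Unary using (Pred; Decidable)

private
  variable
    a a′ a″ ℓ ℓ′ : Level
    A : Set a
    A′ : Set a′
    A″ : Set a″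
    P : Set ℓ
    Q : Set ℓ′
    m n : ℕ

-- Finite sums and counting

∑ : List A → (A → ℕ) → ℕ
∑ xs f = sum (map f xs)

infixr 6.5 ∑-syntax
∑-syntax : List A → (A → ℕ) → ℕ
∑-syntax = ∑

syntax ∑-syntax xs (λ x → e) = ∑[ x ← xs ] e

-- The Iverson bracket. Cardinalities become sums of it, which turns double counting into `∑-swap`.
⟦_⟧ : Dec P → ℕ
⟦ P? ⟧ = if does P? then 1 else 0

⟦⟧-yes : (P? : Dec P) → P → ⟦ P? ⟧ ≡ 1
⟦⟧-yes (yes _) _ = refl
⟦⟧-yes (no ¬P) P = contradiction P ¬P

⟦⟧-no : (P? : Dec P) → ¬ P → ⟦ P? ⟧ ≡ 0
⟦⟧-no (yes P) ¬P = contradiction P ¬P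
⟦⟧-no (no _)  _  = refl

⟦⟧-≤ : ∀ {m} (P? : Dec P) → (P → 1 ≤ m) → ⟦ P? ⟧ ≤ m
⟦⟧-≤ (yes P) 1≤m = 1≤m P
⟦⟧-≤ (no _)  _   = z≤n

⟦⟧-mono : (P? : Dec P) (Q? : Dec Q) → (P → Q) → ⟦ P? ⟧ ≤ ⟦ Q? ⟧
⟦⟧-mono P? Q? P⇒Q = ⟦⟧-≤ P? λ P → ≤-reflexive (sym (⟦⟧-yes Q? (P⇒Q P)))

module _ {f g : A → ℕ} where

  ∑-mono : ∀ xs → (∀ {x} → x ∈ xs → f x ≤ g x) → ∑ xs f ≤ ∑ xs g
  ∑-mono []       _   = z≤n
  ∑-mono (x ∷ xs) f≤g = +-mono-≤ (f≤g (here refl)) (∑-mono xs (f≤g ∘ there))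

  ∑-cong : ∀ xs → (∀ x → f x ≡ g x) → ∑ xs f ≡ ∑ xs g
  ∑-cong xs f≗g = cong sum (List.map-cong f≗g xs)

  ∑-+ : ∀ xs → ∑[ x ← xs ] (f x + g x) ≡ ∑ xs f + ∑ xs g
  ∑-+ []       = refl
  ∑-+ (x ∷ xs) = trans (cong (f x + g x +_) (∑-+ xs))
    (interchange +-commutativeSemigroup (f x) (g x) (∑ xs f) (∑ xs g))

∑-* : ∀ (xs : List A) m {f : A → ℕ} → ∑[ x ← xs ] (m * f x) ≡ m * ∑ xs f
∑-* []       m     = sym (*-zeroʳ m)
∑-* (x ∷ xs) m {f} = trans (cong (m * f x +_) (∑-* xs m)) (sym (*-distribˡ-+ m (f x) (∑ xs f)))

∑-const : ∀ (xs : List A) m → ∑[ _ ← xs ] m ≡ length xs * m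
∑-const []       m = refl
∑-const (x ∷ xs) m = cong (m +_) (∑-const xs m)

∑-1 : ∀ (xs : List A) → ∑[ _ ← xs ] 1 ≡ length xs
∑-1 xs = trans (∑-const xs 1) (*-identityʳ (length xs))

∈⇒≤∑ : ∀ {x : A} {xs} {f : A → ℕ} → x ∈ xs → f x ≤ ∑ xs f
∈⇒≤∑ (here refl)  = m≤m+n _ _
∈⇒≤∑ (there x∈xs) = ≤-trans (∈⇒≤∑ x∈xs) (m≤n+m _ _)

∑-swap : ∀ (xs : List A) (ys : List A′) {f : A → A′ → ℕ} →
         ∑[ x ← xs ] ∑[ y ← ys ] f x y ≡ ∑[ y ← ys ] ∑[ x ← xs ] f x y
∑-swap []       ys     = sym (trans (∑-const ys 0) (*-zeroʳ (length ys)))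
∑-swap (x ∷ xs) ys {f} = trans (cong (∑ ys (f x) +_) (∑-swap xs ys)) (sym (∑-+ ys))

∑-++ : ∀ (xs ys : List A) {f : A → ℕ} → ∑ (xs ++ ys) f ≡ ∑ xs f + ∑ ys f
∑-++ []       ys     = refl
∑-++ (x ∷ xs) ys {f} = trans (cong (f x +_) (∑-++ xs ys)) (sym (+-assoc (f x) _ _))

∑-map : ∀ (xs : List A) {g : A → A′} {f : A′ → ℕ} → ∑ (map g xs) f ≡ ∑[ x ← xs ] f (g x)
∑-map xs = cong sum (sym (List.map-∘ xs))

∑-cartesianProductWith : ∀ (xs : List A) (ys : List A′) {g : A → A′ → A″} {f : A″ → ℕ} →
  ∑ (cartesianProductWith g xs ys) f ≡ ∑[ x ← xs ] ∑[ y ← ys ] f (g x y)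
∑-cartesianProductWith []       ys         = refl
∑-cartesianProductWith (x ∷ xs) ys {g} {f} = begin
  ∑ (map (g x) ys ++ cartesianProductWith g xs ys) f  ≡⟨ ∑-++ (map (g x) ys) _ ⟩
  ∑ (map (g x) ys) f + ∑ (cartesianProductWith g xs ys) f
    ≡⟨ cong₂ _+_ (∑-map ys) (∑-cartesianProductWith xs ys) ⟩
  _                                                   ∎
  where open ≡-Reasoning

length-cartesianProductWith : ∀ (g : A → A′ → A″) xs ys →
  length (cartesianProductWith g xs ys) ≡ length xs * length ys
length-cartesianProductWith g xs ys = begin
  length (cartesianProductWith g xs ys)       ≡⟨ ∑-1 (cartesianProductWith g xs ys) ⟨
  ∑ (cartesianProductWith g xs ys) (λ _ → 1)  ≡⟨ ∑-cartesianProductWith xs ys ⟩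
  ∑[ _ ← xs ] ∑[ _ ← ys ] 1                   ≡⟨ ∑-const xs _ ⟩
  length xs * ∑ ys (λ _ → 1)                  ≡⟨ cong (length xs *_) (∑-1 ys) ⟩
  length xs * length ys                       ∎
  where open ≡-Reasoning

∑-allFin-suc : ∀ n {f : Fin (suc n) → ℕ} → ∑ (allFin (suc n)) f ≡ f zero + ∑[ i ← allFin n ] f (suc i)
∑-allFin-suc n {f} = cong (λ xs → f zero + sum xs)
  (trans (List.map-tabulate suc f) (sym (List.map-tabulate id (f ∘ suc))))

module _ {P : Pred A ℓ} (P? : Decidable P) where

  ∑-filter : ∀ xs {f : A → ℕ} → ∑ (filter P? xs) f ≡ ∑[ x ← xs ] (⟦ P? x ⟧ * f x)
  ∑-filter []           = refl
  ∑-filter (x ∷ xs) {f} with does (P? x)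
  ... | true  = cong₂ _+_ (sym (*-identityˡ (f x))) (∑-filter xs)
  ... | false = ∑-filter xs

  length-filter-∑ : ∀ xs → length (filter P? xs) ≡ ∑[ x ← xs ] ⟦ P? x ⟧
  length-filter-∑ []       = refl
  length-filter-∑ (x ∷ xs) with does (P? x)
  ... | true  = cong suc (length-filter-∑ xs)
  ... | false = length-filter-∑ xs

  ∑-⟦⟧-Any : ∀ {xs} → Any P xs → 1 ≤ ∑[ x ← xs ] ⟦ P? x ⟧
  ∑-⟦⟧-Any {x ∷ _} (here Px) = ≤-trans (≤-reflexive (sym (⟦⟧-yes (P? x) Px))) (m≤m+n _ _)
  ∑-⟦⟧-Any (there any)       = ≤-trans (∑-⟦⟧-Any any) (m≤n+m _ _)

  ∑-⟦⟧-none : ∀ {xs} → All (¬_ ∘ P) xs → ∑[ x ← xs ] ⟦ P? x ⟧ ≡ 0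
  ∑-⟦⟧-none []                 = refl
  ∑-⟦⟧-none {x ∷ _} (¬Px ∷ ¬P) = cong₂ _+_ (⟦⟧-no (P? x) ¬Px) (∑-⟦⟧-none ¬P)

  ∑-⟦⟧-atMostOne : ∀ {xs} → Unique xs → (∀ {x y} → x ∈ xs → y ∈ xs → P x → P y → x ≡ y) →
                   ∑[ x ← xs ] ⟦ P? x ⟧ ≤ 1
  ∑-⟦⟧-atMostOne []                        _   = z≤n
  ∑-⟦⟧-atMostOne {x ∷ xs} (x∉xs ∷ xs-uniq) one with P? x
  ... | yes Px = s≤s (≤-reflexive (∑-⟦⟧-none (All.tabulate λ y∈xs Py →
                   All.lookup x∉xs y∈xs (one (here refl) (there y∈xs) Px Py))))
  ... | no _   = ∑-⟦⟧-atMostOne xs-uniq (λ x∈ y∈ → one (there x∈) (there y∈))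

-- Double counting of the pairs `(x , y)` with `f x ≡ y` and `Q y`: each `x` satisfying `P` lies in
-- at least one, and by injectivity each `y` lies in at most one.
∑-⟦⟧-injection :
  ∀ {P : Pred A ℓ} {Q : Pred A′ ℓ′} (P? : Decidable P) (Q? : Decidable Q) → DecidableEquality A′ →
  ∀ {xs ys} → Unique xs → (f : A → A′) → (∀ {x y} → f x ≡ f y → x ≡ y) →
  (∀ {x} → x ∈ xs → P x → f x ∈ ys × Q (f x)) →
  ∑[ x ← xs ] ⟦ P? x ⟧ ≤ ∑[ y ← ys ] ⟦ Q? y ⟧
∑-⟦⟧-injection P? Q? _≟_ {xs} {ys} xs-uniq f f-inj f-maps = begin
  ∑[ x ← xs ] ⟦ P? x ⟧                              ≤⟨ ∑-mono xs hit ⟩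
  ∑[ x ← xs ] ∑[ y ← ys ] ⟦ Q? y ×-dec (f x ≟ y) ⟧  ≡⟨ ∑-swap xs ys ⟩
  ∑[ y ← ys ] ∑[ x ← xs ] ⟦ Q? y ×-dec (f x ≟ y) ⟧  ≤⟨ ∑-mono ys (λ {y} _ → fibre y) ⟩
  ∑[ y ← ys ] ⟦ Q? y ⟧                              ∎
  where
  open ≤-Reasoning

  hit : ∀ {x} → x ∈ xs → ⟦ P? x ⟧ ≤ ∑[ y ← ys ] ⟦ Q? y ×-dec (f x ≟ y) ⟧
  hit {x} x∈xs = ⟦⟧-≤ (P? x) λ Px → let fx∈ys , Qfx = f-maps x∈xs Px in
    ∑-⟦⟧-Any (λ y → Q? y ×-dec (f x ≟ y)) (Any.map (λ { refl → Qfx , refl }) fx∈ys)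

  fibre : ∀ y → ∑[ x ← xs ] ⟦ Q? y ×-dec (f x ≟ y) ⟧ ≤ ⟦ Q? y ⟧
  fibre y with Q? y
  ... | yes _ = ∑-⟦⟧-atMostOne (λ x → f x ≟ y) xs-uniq λ _ _ fx≡y fx′≡y → f-inj (trans fx≡y (sym fx′≡y))
  ... | no _  = ≤-reflexive (trans (∑-const xs 0) (*-zeroʳ (length xs)))

-- PPZ along a satisfying assignment

Before : Fin n → Fin n → Vec (Fin n) m → Set
Before v x []      = ⊥
Before v x (w ∷ π) = w ≢ x × (v ≡ w ⊎ Before v x π)

-- The literals compatible with a unit clause at `x`: the literal of `x` that `z` satisfies, and
-- those false under `z` that get deleted before `x` is reached.
Pending : Assignment n → Vec (Fin n) m → Fin n → Literal n → Set
Pending z π x (v , b) = (v , b) ≡ (x , lookup z x) ⊎ (lookup z v ≢ b × Before v x π)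

-- The clause c turns into the unit clause of x by the time PPZ reaches x,
-- provided that the variables before x receive their values from z.
BecomesUnit : CNF n → Assignment n → Vec (Fin n) m → Fin n → Set
BecomesUnit F z π x = Any (λ c → (x , lookup z x) ∈ c × All (Pending z π x) c) F

-- A literal made true by `z` is never the deleted one, so each surviving clause keeps its witness.
substitute-⊨ : ∀ {F : CNF n} z w → z ⊨ F → z ⊨ substitute w (lookup z w) F
substitute-⊨ {F = F} z w z⊨F = All.tabulate λ c′∈ →
  let c , c∈F , c′≡ , _ = ∈-map∘filter⁻ (filter λ l → ¬? (l ≟ˡ (w , not (lookup z w)))) _ c′∈
      l , l∈c , zl      = find (All.lookup z⊨F c∈F)
  in subst (Any (Makes-true z)) (sym c′≡)
       (lose (∈-filter⁺ _ l∈c (survives zl)) zl)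
  where
  survives : ∀ {l} → Makes-true z l → l ≢ (w , not (lookup z w))
  survives zl refl = Bool.not-¬ refl zl

-- Since `w` is not `x`, a pending literal on `w` is false under `z`. Hence the clause is not
-- removed as satisfied, and its literals on `w` are deleted.
becomesUnit-substitute : ∀ {F : CNF n} z {w x} {π : Vec (Fin n) m} → w ≢ x →
  BecomesUnit F z (w ∷ π) x → BecomesUnit (substitute w (lookup z w) F) z π x
becomesUnit-substitute z {w} {x} {π} w≢x unit with find unit
... | c , c∈F , x∈c , pending =
  lose (∈-map⁺ _ (∈-filter⁺ _ c∈F (survives pending)))
       ( ∈-filter⁺ _ x∈c (w≢x ∘ sym ∘ cong proj₁)
       , All.tabulate λ l∈ → let l∈c , l≢ = ∈-filter⁻ _ l∈ in step l≢ (All.lookup pending l∈c))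
  where
  survives : ∀ {c} → All (Pending z (w ∷ π) x) c → ¬ Any ((w , lookup z w) ≡_) c
  survives (inj₁ l≡     ∷ _) (here refl) = w≢x (cong proj₁ l≡)
  survives (inj₂ (z≢ , _) ∷ _) (here refl) = z≢ refl
  survives (_ ∷ ps) (there any) = survives ps any

  step : ∀ {l} → l ≢ (w , not (lookup z w)) → Pending z (w ∷ π) x l → Pending z π x l
  step l≢ (inj₁ l≡)                       = inj₁ l≡
  step l≢ (inj₂ (z≢ , _ , inj₁ refl))     = contradiction (cong (w ,_) (Bool.¬-not (z≢ ∘ sym))) l≢
  step l≢ (inj₂ (z≢ , _ , inj₂ before))   = inj₂ (z≢ , before)

becomesUnit-head : ∀ {F : CNF n} z {x} {π : Vec (Fin n) m} →
  BecomesUnit F z (x ∷ π) x → HasUnit (x , lookup z x) F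
becomesUnit-head z = Any.map λ (x∈c , pending) → x∈c , All.map (λ
  { (inj₁ l≡)               → l≡
  ; (inj₂ (_ , x≢x , _))    → contradiction refl x≢x }) pending

hasUnit-⊨ : ∀ {F : CNF n} z {x b} → z ⊨ F → HasUnit (x , b) F → lookup z x ≡ b
hasUnit-⊨ z z⊨F unit with find unit
... | c , c∈F , _ , c⊆l with find (All.lookup z⊨F c∈F)
... | l , l∈c , zl with refl ← All.lookup c⊆l l∈c = zl

-- A unit clause present in `F` must be satisfied by `z`, so propagation never contradicts `z`; the
-- base value decides only when there is no unit clause on `x`.
ppzValue-agrees : ∀ {F : CNF n} z y {x} → z ⊨ F →
  lookup y x ≡ lookup z x ⊎ HasUnit (x , lookup z x) F → ppzValue F y x ≡ lookup z x
ppzValue-agrees {F = F} z y {x} z⊨F ok with hasUnit? (x , true) F | hasUnit? (x , false) F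
... | yes unit | _        = sym (hasUnit-⊨ z z⊨F unit)
... | no _     | yes unit = sym (hasUnit-⊨ z z⊨F unit)
... | no ¬true | no ¬false with ok
...   | inj₁ yx≡zx = yx≡zx
...   | inj₂ unit with lookup z x
...     | true  = contradiction unit ¬true
...     | false = contradiction unit ¬false

-- Induction along the order: `z` keeps satisfying the formula, and clauses that are to become unit
-- keep that property. Tuples of any length are allowed so that the hypothesis applies to the tail
-- of a permutation.
ppz-agrees : ∀ {F : CNF n} z y {π : Vec (Fin n) m} → z ⊨ F → VecUnique.Unique π →
  (∀ {x} → x Vec.∈ π → lookup y x ≡ lookup z x ⊎ BecomesUnit F z π x) →
  ∀ {x} → x Vec.∈ π → lookup (ppz F y π) x ≡ lookup z x
ppz-agrees {F = F} z y {w ∷ π} z⊨F (w∉π VecAllPairs.∷ π!) ok {x} = λ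
  { (VecAny.here refl) → trans (Vec.lookup∘update w (ppz _ y π) _) head
  ; (VecAny.there x∈π) → trans
      (Vec.lookup∘update′ (VecAll.lookup w∉π x∈π ∘ sym) (ppz _ y π) _)
      (subst (λ u → lookup (ppz (substitute w u F) y π) x ≡ lookup z x) (sym head) (tail x∈π)) }
  where
  head : ppzValue F y w ≡ lookup z w
  head = ppzValue-agrees z y z⊨F (Sum.map₂ (becomesUnit-head z) (ok (VecAny.here refl)))

  tail : x Vec.∈ π → lookup (ppz (substitute w (lookup z w) F) y π) x ≡ lookup z x
  tail = ppz-agrees z y (substitute-⊨ z w z⊨F) π! λ x′∈π →
    Sum.map₂ (becomesUnit-substitute z (VecAll.lookup w∉π x′∈π)) (ok (VecAny.there x′∈π))

-- The `y` that match `z` outside `G` form a subcube whose dimension is the size of `G`: a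
-- coordinate in `G` allows both bits, any other only the bit of `z`.
agreeing-count : ∀ n {p q} {G : Pred (Fin n) p} {Q : Pred (Assignment n) q}
  (G? : Decidable G) (Q? : Decidable Q) (z : Assignment n) →
  (∀ y → (∀ i → lookup y i ≡ lookup z i ⊎ G i) → Q y) →
  2 ^ (∑[ i ← allFin n ] ⟦ G? i ⟧) ≤ ∑[ y ← assignments n ] ⟦ Q? y ⟧
agreeing-count zero    G? Q? []      agree⇒Q =
  ≤-trans (≤-reflexive (sym (⟦⟧-yes (Q? []) (agree⇒Q [] λ ())))) (m≤m+n _ 0)
agreeing-count (suc n) {G = G} {Q} G? Q? (b₀ ∷ z) agree⇒Q = begin
  2 ^ (∑[ i ← allFin (suc n) ] ⟦ G? i ⟧)  ≡⟨ cong (2 ^_) (∑-allFin-suc n {λ i → ⟦ G? i ⟧}) ⟩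
  2 ^ (⟦ G? zero ⟧ + N′)                  ≤⟨ split (G? zero) ⟩
  ∑ (false ∷ true ∷ []) count
    ≡⟨ ∑-cartesianProductWith (false ∷ true ∷ []) (assignments n) {_∷_} ⟨
  ∑[ y ← assignments (suc n) ] ⟦ Q? y ⟧   ∎
  where
  open ≤-Reasoning
  N′ = ∑[ i ← allFin n ] ⟦ G? (suc i) ⟧

  count : Bool → ℕ
  count b = ∑[ y ← assignments n ] ⟦ Q? (b ∷ y) ⟧

  half : ∀ b → b ≡ b₀ ⊎ G zero → 2 ^ N′ ≤ count b
  half b ok = agreeing-count n (G? ∘ suc) (Q? ∘ (b ∷_)) z λ y agree →
    agree⇒Q (b ∷ y) λ { zero → ok ; (suc i) → agree i }

  split : (d : Dec (G zero)) → 2 ^ (⟦ d ⟧ + N′) ≤ ∑ (false ∷ true ∷ []) count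
  split (yes G₀) = +-mono-≤ (half false (inj₂ G₀)) (+-monoˡ-≤ 0 (half true (inj₂ G₀)))
  split (no _)   = ≤-trans (half b₀ (inj₁ refl)) (∈⇒≤∑ {f = count} (b∈ b₀))
    where
    b∈ : ∀ b → b ∈ false ∷ true ∷ []
    b∈ false = here refl
    b∈ true  = there (here refl)

-- Orders in which a given variable comes last

before? : (v x : Fin n) (π : Vec (Fin n) m) → Dec (Before v x π)
before? v x []      = no id
before? v x (w ∷ π) = ¬? (w Fin.≟ x) ×-dec (v Fin.≟ w ⊎-dec before? v x π)

before-trans : ∀ {u v x : Fin n} (π : Vec (Fin n) m) → Before u v π → Before v x π → Before u x π
before-trans (w ∷ π) (w≢v , _)        (_   , inj₁ v≡w) = contradiction (sym v≡w) w≢v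
before-trans (w ∷ π) (_   , inj₁ u≡w) (w≢x , inj₂ _)   = w≢x , inj₁ u≡w
before-trans (w ∷ π) (_   , inj₂ u<v) (w≢x , inj₂ v<x) = w≢x , inj₂ (before-trans π u<v v<x)

before-total : ∀ {v x : Fin n} {π : Vec (Fin n) m} → v Vec.∈ π → x Vec.∈ π →
               v ≡ x ⊎ Before v x π ⊎ Before x v π
before-total {v = v} {x} {w ∷ π} v∈ x∈ with w Fin.≟ v | w Fin.≟ x
... | yes refl | yes refl = inj₁ refl
... | yes refl | no w≢x   = inj₂ (inj₁ (w≢x , inj₁ refl))
... | no w≢v   | yes refl = inj₂ (inj₂ (w≢v , inj₁ refl))
... | no w≢v   | no w≢x   = Sum.map₂ (Sum.map (λ b → w≢x , inj₂ b) (λ b → w≢v , inj₂ b))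
                              (before-total (VecAny.tail (w≢v ∘ sym) v∈) (VecAny.tail (w≢x ∘ sym) x∈))

before-map : ∀ {f : Fin n → Fin n} → (∀ {x y} → f x ≡ f y → x ≡ y) →
  ∀ {v x} (π : Vec (Fin n) m) → Before v x π → Before (f v) (f x) (Vec.map f π)
before-map f-inj (w ∷ π) (w≢x , v≤w) = w≢x ∘ f-inj , Sum.map (cong _) (before-map f-inj π) v≤w

Last : Fin n → List (Fin n) → Vec (Fin n) m → Set
Last v vs π = All (λ u → u ≡ v ⊎ Before u v π) vs

last? : (v : Fin n) (vs : List (Fin n)) (π : Vec (Fin n) m) → Dec (Last v vs π)
last? v vs π = All.all? (λ u → u Fin.≟ v ⊎-dec before? u v π) vs

-- The head is compared with the last member of the tail. The membership hypothesis serves as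
-- nonemptiness of `vs`.
last-exists : ∀ {π : Vec (Fin n) m} → (∀ u → u Vec.∈ π) → ∀ {i vs} → i ∈ vs → Any (λ v → Last v vs π) vs
last-exists all∈ {vs = x ∷ []}     _ = here (inj₁ refl ∷ [])
last-exists {π = π} all∈ {vs = x ∷ y ∷ vs} _ with find (last-exists all∈ (here refl))
... | v , v∈ , last with before-total (all∈ x) (all∈ v)
...   | inj₁ x≡v        = there (lose v∈ (inj₁ x≡v ∷ last))
...   | inj₂ (inj₁ x<v) = there (lose v∈ (inj₂ x<v ∷ last))
...   | inj₂ (inj₂ v<x) = here (inj₁ refl ∷ All.map
          (λ { (inj₁ refl) → inj₂ v<x ; (inj₂ u<v) → inj₂ (before-trans π u<v v<x) }) last)

transpose-injective : ∀ (i j : Fin n) {x y} → transpose i j x ≡ transpose i j y → x ≡ y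
transpose-injective i j eq = trans (sym (transpose-inverse j i)) (trans (cong (transpose j i) eq)
  (transpose-inverse j i))

transpose-fst : ∀ (i j : Fin n) → transpose i j i ≡ j
transpose-fst i j rewrite dec-true (i Fin.≟ i) refl = refl

transpose-∈ : ∀ {i j k : Fin n} {vs} → i ∈ vs → j ∈ vs → k ∈ vs → transpose i j k ∈ vs
transpose-∈ {i = i} {j} {k} i∈ j∈ k∈ with does (k Fin.≟ i)
... | true  = j∈
... | false with does (k Fin.≟ j)
...   | true  = i∈
...   | false = k∈

-- Exchanging the names `v` and `i` leaves the positions alone and maps `vs` to itself, since it
-- contains both.
last-transpose : ∀ {i v : Fin n} {vs} {π : Vec (Fin n) m} → i ∈ vs → v ∈ vs →
  Last v vs π → Last i vs (Vec.map (transpose v i) π)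
last-transpose {i = i} {v} {π = π} i∈ v∈ last = All.tabulate λ {u} u∈ →
  Sum.map
    (λ u′≡v → trans (sym (transpose-inverse v i)) (trans (cong (transpose v i) u′≡v) (transpose-fst v i)))
    (λ before → subst₂ (λ u x → Before u x (Vec.map (transpose v i) π))
      (transpose-inverse v i) (transpose-fst v i)
      (before-map (transpose-injective v i) π before))
    (All.lookup last (transpose-∈ i∈ v∈ u∈))

lookup-ext : ∀ {xs ys : Vec A n} → (∀ i → lookup xs i ≡ lookup ys i) → xs ≡ ys
lookup-ext {xs = xs} {ys} eq =
  trans (sym (Vec.tabulate∘lookup xs)) (trans (Vec.tabulate-cong eq) (Vec.tabulate∘lookup ys))

vec-map-injective : ∀ {f : A → A} → (∀ {x y} → f x ≡ f y → x ≡ y) →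
                    ∀ {xs ys : Vec A n} → Vec.map f xs ≡ Vec.map f ys → xs ≡ ys
vec-map-injective f-inj {[]}     {[]}     _  = refl
vec-map-injective f-inj {x ∷ xs} {y ∷ ys} eq =
  cong₂ _∷_ (f-inj (Vec.∷-injectiveˡ eq)) (vec-map-injective f-inj (Vec.∷-injectiveʳ eq))

∈-vectors : ∀ {xs : List A} {v : Vec A n} → VecAll.All (_∈ xs) v → v ∈ vectors xs n
∈-vectors VecAll.[]         = here refl
∈-vectors (x∈ VecAll.∷ v∈) = ∈-cartesianProductWith⁺ _∷_ x∈ (∈-vectors v∈)

vectors-unique : ∀ {xs : List A} → Unique xs → ∀ n → Unique (vectors xs n)
vectors-unique xs! zero    = [] ∷ []
vectors-unique xs! (suc n) = Unique.cartesianProductWith⁺ _∷_ Vec.∷-injective xs! (vectors-unique xs! n)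

∈-assignments : (z : Assignment n) → z ∈ assignments n
∈-assignments z = ∈-vectors (VecAll.universal (λ { false → here refl ; true → there (here refl) }) z)

assignments-unique : ∀ n → Unique (assignments n)
assignments-unique = vectors-unique (((λ ()) ∷ []) ∷ [] ∷ [])

∈-permutations⁺ : ∀ {π : Vec (Fin n) n} → VecUnique.Unique π → π ∈ permutations n
∈-permutations⁺ {π = π} π! = ∈-filter⁺ _ (∈-vectors (VecAll.universal ∈-allFin π)) π!

∈-permutations⁻ : ∀ {π : Vec (Fin n) n} → π ∈ permutations n → VecUnique.Unique π
∈-permutations⁻ π∈ = proj₂ (∈-filter⁻ _ {xs = vectors (allFin _) _} π∈)

permutations-unique : ∀ n → Unique (permutations n)
permutations-unique n = Unique.filter⁺ _ (vectors-unique (Unique.allFin⁺ n) n)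

-- Pigeonhole: a missing `x` would extend `π` to `suc n` distinct elements of `Fin n`.
permutation-∈ : ∀ {π : Vec (Fin n) n} → VecUnique.Unique π → ∀ x → x Vec.∈ π
permutation-∈ {n} {π} π! x with VecDec._∈?_ Fin._≟_ x π
... | yes x∈π = x∈π
... | no x∉π  = contradiction (Fin.injective⇒≤ (VecUnique.lookup-injective x∷π! _ _)) (1+n≰n {n})
  where
  x∷π! : VecUnique.Unique (x ∷ π)
  x∷π! = VecAll.lookup⁻ (λ i x≡ → x∉π (subst (Vec._∈ π) (sym x≡) (Vec.∈-lookup i π))) VecAllPairs.∷ π!

-- In every order some member of `vs` comes last. By symmetry no member is last more often than `i`:
-- exchanging it with `i` injects its orders into those of `i`.
last-count : ∀ {i : Fin n} {vs} → i ∈ vs →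
  length (permutations n) ≤ length vs * (∑[ π ← permutations n ] ⟦ last? i vs π ⟧)
last-count {n} {i} {vs} i∈ = begin
  length (permutations n)                                 ≡⟨ ∑-1 (permutations n) ⟨
  ∑[ _ ← permutations n ] 1
    ≤⟨ ∑-mono (permutations n) (λ {π} π∈ →
       ∑-⟦⟧-Any (λ v → last? v vs π) (last-exists (permutation-∈ (∈-permutations⁻ π∈)) i∈)) ⟩
  ∑[ π ← permutations n ] ∑[ v ← vs ] ⟦ last? v vs π ⟧    ≡⟨ ∑-swap (permutations n) vs ⟩
  ∑[ v ← vs ] ∑[ π ← permutations n ] ⟦ last? v vs π ⟧    ≤⟨ ∑-mono vs relabel ⟩
  ∑[ v ← vs ] ∑[ π ← permutations n ] ⟦ last? i vs π ⟧    ≡⟨ ∑-const vs _ ⟩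
  length vs * (∑[ π ← permutations n ] ⟦ last? i vs π ⟧)  ∎
  where
  open ≤-Reasoning
  relabel : ∀ {v} → v ∈ vs →
    ∑[ π ← permutations n ] ⟦ last? v vs π ⟧ ≤ ∑[ π ← permutations n ] ⟦ last? i vs π ⟧
  relabel {v} v∈ = ∑-⟦⟧-injection (last? v vs) (last? i vs) (Vec.≡-dec Fin._≟_) (permutations-unique n)
    (Vec.map (transpose v i)) (vec-map-injective (transpose-injective v i))
    λ π∈ last → ∈-permutations⁺ (VecUnique.map⁺ (transpose-injective v i) (∈-permutations⁻ π∈))
              , last-transpose i∈ v∈ last

-- Variables forced by critical clauses

flip : Fin n → Assignment n → Assignment n
flip i z = z [ i ]%= not

-- A clause broken by the flip is a critical clause of the usual PPZ analysis. The condition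
-- involves `z` and `π` but not the base value, so `π` can be fixed first and `y` counted
-- afterwards.
Forced : CNF n → Assignment n → Vec (Fin n) m → Fin n → Set
Forced F z π i = Any (λ c → ¬ Any (Makes-true (flip i z)) c × Last i (map proj₁ c) π) F

makes-true? : (z : Assignment n) → Decidable (Makes-true z)
makes-true? z (x , b) = lookup z x Bool.≟ b

forced? : (F : CNF n) (z : Assignment n) (π : Vec (Fin n) m) → Decidable (Forced F z π)
forced? F z π i = Any.any? (λ c → ¬? (Any.any? (makes-true? (flip i z)) c) ×-dec last? i (map proj₁ c) π) F

-- The flip changes only literals on `i`, so the literal that satisfies `c` at `z` must be one of
-- these.
critical-∈ : ∀ (z : Assignment n) {i c} → Any (Makes-true z) c → ¬ Any (Makes-true (flip i z)) c →
             (i , lookup z i) ∈ c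
critical-∈ z {i} z⊨c flip⊭c with find z⊨c
... | (v , b) , l∈c , refl with v Fin.≟ i
...   | yes refl = l∈c
...   | no v≢i   = contradiction (lose l∈c (Vec.lookup∘updateAt′ v i v≢i z)) flip⊭c

-- After the flip all literals of `c` are false. Those on `i` are therefore true at `z` and equal
-- the unit literal; the others are untouched by the flip, so false at `z`, and precede `i` because
-- `i` is last.
forced⇒becomesUnit : ∀ {F : CNF n} z {i} {π : Vec (Fin n) m} → z ⊨ F → Forced F z π i → BecomesUnit F z π i
forced⇒becomesUnit z {i} {π} z⊨F forced with find forced
... | c , c∈F , flip⊭c , last = lose c∈F (critical-∈ z (All.lookup z⊨F c∈F) flip⊭c , All.tabulate pending)
  where
  pending : ∀ {l} → l ∈ c → Pending z π i l
  pending {v , b} l∈c with v Fin.≟ i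
  ... | yes refl = inj₁ (cong (i ,_) (sym (trans (Bool.¬-not z≢b) (Bool.not-involutive b))))
    where
    z≢b : lookup z i ≢ not b
    z≢b z≡ = flip⊭c (lose l∈c (trans (Vec.lookup∘updateAt i z) (trans (cong not z≡) (Bool.not-involutive b))))
  ... | no v≢i   = inj₂ ( (λ z≡b → flip⊭c (lose l∈c (trans (Vec.lookup∘updateAt′ v i v≢i z) z≡b)))
                        , Sum.[ (λ v≡i → contradiction v≡i v≢i) , id ]′ (All.lookup last (∈-map⁺ proj₁ l∈c)))

_≟ᵃ_ : (y z : Assignment n) → Dec (y ≡ z)
_≟ᵃ_ = Vec.≡-dec Bool._≟_

#forced : CNF n → Assignment n → Vec (Fin n) n → ℕ
#forced {n} F z π = ∑[ i ← allFin n ] ⟦ forced? F z π i ⟧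

-- Only the unforced coordinates of `y` have to match `z`; the forced ones are free.
output-count : ∀ {F : CNF n} {z π} → z ⊨ F → π ∈ permutations n →
  2 ^ #forced F z π ≤ ∑[ y ← assignments n ] ⟦ ppz F y π ≟ᵃ z ⟧
output-count {n} {F} {z} {π} z⊨F π∈ = agreeing-count n (forced? F z π) (λ y → ppz F y π ≟ᵃ z) z λ y agree →
  lookup-ext λ x → ppz-agrees z y z⊨F π!
    (λ {x} _ → Sum.map₂ (forced⇒becomesUnit z z⊨F) (agree x)) (permutation-∈ π! x)
  where π! = ∈-permutations⁻ π∈

-- The flip falsifies some clause, which contains `i` and has at most `k` literals; `i` is forced in
-- every order that puts it last in that clause.
forced-count : ∀ {k} {F : CNF n} z {i} → IsKCNF k F → z ⊨ F → ¬ flip i z ⊨ F →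
  length (permutations n) ≤ k * (∑[ π ← permutations n ] ⟦ forced? F z π i ⟧)
forced-count {n} {k} {F} z {i} kcnf z⊨F flip⊭F
  with find (All.¬All⇒Any¬ (Any.any? (makes-true? (flip i z))) F flip⊭F)
... | c , c∈F , flip⊭c = begin
  length (permutations n)
    ≤⟨ last-count (∈-map⁺ proj₁ (critical-∈ z (All.lookup z⊨F c∈F) flip⊭c)) ⟩
  length (map proj₁ c) * (∑[ π ← permutations n ] ⟦ last? i (map proj₁ c) π ⟧)
    ≤⟨ *-mono-≤ (≤-trans (≤-reflexive (List.length-map proj₁ c)) (All.lookup kcnf c∈F))
         (∑-mono (permutations n) λ {π} _ →
           ⟦⟧-mono (last? i (map proj₁ c) π) (forced? F z π i) (λ last → lose c∈F (flip⊭c , last))) ⟩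
  k * (∑[ π ← permutations n ] ⟦ forced? F z π i ⟧)  ∎
  where open ≤-Reasoning

-- Balls of solutions

differs? : (z s : Assignment n) → Decidable (λ i → lookup z i ≢ lookup s i)
differs? z s i = ¬? (lookup z i Bool.≟ lookup s i)

d-H-∑ : (z s : Assignment n) → d-H z s ≡ ∑[ i ← allFin n ] ⟦ differs? z s i ⟧
d-H-∑ []      []      = refl
d-H-∑ {suc n} (b ∷ z) (c ∷ s) = trans (split (b Bool.≟ c)) (sym (∑-allFin-suc n))
  where
  split : (d : Dec (b ≡ c)) →
    (if does (¬? d) then suc else id) (d-H z s) ≡ ⟦ ¬? d ⟧ + ∑[ i ← allFin n ] ⟦ differs? z s i ⟧
  split (yes _) = d-H-∑ z s
  split (no _)  = cong suc (d-H-∑ z s)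

d-H-refl : (z : Assignment n) → d-H z z ≡ 0
d-H-refl z = trans (d-H-∑ z z) (∑-⟦⟧-none (differs? z z) (All.universal (λ _ z≢z → z≢z refl) (allFin _)))

d-H≡0⇒≡ : (z s : Assignment n) → d-H z s ≡ 0 → z ≡ s
d-H≡0⇒≡ z s d≡0 = lookup-ext λ i → decidable-stable (lookup z i Bool.≟ lookup s i) λ z≢s →
  contradiction (trans (sym (d-H-∑ z s)) d≡0) (>⇒≢ (∑-⟦⟧-Any (differs? z s) (lose (∈-allFin i) z≢s)))

d-H-triangle : (z s t : Assignment n) → d-H s t ≤ d-H z s + d-H z t
d-H-triangle {n} z s t = begin
  d-H s t                                                      ≡⟨ d-H-∑ s t ⟩
  ∑[ i ← allFin n ] ⟦ differs? s t i ⟧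
    ≤⟨ ∑-mono (allFin n) (λ {i} _ → ⟦⟧-≤ (differs? s t i) (differs i)) ⟩
  ∑[ i ← allFin n ] (⟦ differs? z s i ⟧ + ⟦ differs? z t i ⟧)  ≡⟨ ∑-+ (allFin n) ⟩
  ∑[ i ← allFin n ] ⟦ differs? z s i ⟧ + ∑[ i ← allFin n ] ⟦ differs? z t i ⟧
    ≡⟨ cong₂ _+_ (d-H-∑ z s) (d-H-∑ z t) ⟨
  d-H z s + d-H z t                                            ∎
  where
  open ≤-Reasoning
  differs : ∀ i → lookup s i ≢ lookup t i → 1 ≤ ⟦ differs? z s i ⟧ + ⟦ differs? z t i ⟧
  differs i s≢t with lookup z i Bool.≟ lookup s i
  ... | no _    = s≤s z≤n
  ... | yes z≡s = ≤-reflexive (sym (⟦⟧-yes (¬? (lookup z i Bool.≟ lookup t i)) (s≢t ∘ trans (sym z≡s))))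

d-H-flip : ∀ i (z s : Assignment n) → d-H (flip i z) s ≤ suc (d-H z s)
d-H-flip zero (b ∷ z) (c ∷ s) = bound (does (¬? (not b Bool.≟ c))) (does (¬? (b Bool.≟ c)))
  where
  bound : ∀ p q → (if p then suc else id) (d-H z s) ≤ suc ((if q then suc else id) (d-H z s))
  bound false false = n≤1+n _
  bound false true  = m≤n+m _ 2
  bound true  false = ≤-refl
  bound true  true  = n≤1+n _
d-H-flip (suc i) (b ∷ z) (c ∷ s) with does (¬? (b Bool.≟ c))
... | false = d-H-flip i z s
... | true  = s≤s (d-H-flip i z s)

flip-involutive : ∀ i (z : Assignment n) → flip i (flip i z) ≡ z
flip-involutive i z = trans (Vec.updateAt-updateAt i z) (Vec.updateAt-id-local i z (Bool.not-involutive _))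

flip-injective : ∀ i {z y : Assignment n} → flip i z ≡ flip i y → z ≡ y
flip-injective i {z} {y} eq =
  trans (sym (flip-involutive i z)) (trans (cong (flip i) eq) (flip-involutive i y))

Ω-unique : (F : CNF n) → Unique (Ω F)
Ω-unique {n} F = Unique.filter⁺ (_⊨? F) (assignments-unique n)

∈-Ω⁺ : ∀ {F : CNF n} {z} → z ⊨ F → z ∈ Ω F
∈-Ω⁺ {F = F} {z} = ∈-filter⁺ (_⊨? F) (∈-assignments z)

∈-Ω⁻ : ∀ {F : CNF n} {z} → z ∈ Ω F → z ⊨ F
∈-Ω⁻ {F = F} z∈ = proj₂ (∈-filter⁻ (_⊨? F) {xs = assignments _} z∈)

ball : CNF n → Assignment n → ℕ → List (Assignment n)
ball F s t = filter (λ z → d-H z s ≤? t) (Ω F)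

∈-ball⁺ : ∀ {F : CNF n} {s z t} → z ⊨ F → d-H z s ≤ t → z ∈ ball F s t
∈-ball⁺ {s = s} {t = t} z⊨F = ∈-filter⁺ (λ z → d-H z s ≤? t) (∈-Ω⁺ z⊨F)

∈-ball⁻ : ∀ {F : CNF n} {s z t} → z ∈ ball F s t → z ⊨ F × d-H z s ≤ t
∈-ball⁻ {F = F} {s} {t = t} z∈ =
  let z∈Ω , z≤t = ∈-filter⁻ (λ z → d-H z s ≤? t) {xs = Ω F} z∈ in ∈-Ω⁻ z∈Ω , z≤t

ball-unique : ∀ (F : CNF n) s t → Unique (ball F s t)
ball-unique F s t = Unique.filter⁺ (λ z → d-H z s ≤? t) (Ω-unique F)

#neighbours : CNF n → Assignment n → ℕ
#neighbours {n} F z = ∑[ i ← allFin n ] ⟦ flip i z ⊨? F ⟧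

ball-neighbours : ∀ (F : CNF n) s t →
  ∑[ z ← ball F s t ] #neighbours F z ≤ t * length (ball F s t) + suc t * length (ball F s (suc t))
ball-neighbours {n} F s t = begin
  ∑[ z ← 𝔹 t ] #neighbours F z                   ≤⟨ ∑-mono (𝔹 t) (λ {z} _ → split z) ⟩
  ∑[ z ← 𝔹 t ] (d-H z s + up z)                  ≡⟨ ∑-+ (𝔹 t) ⟩
  ∑[ z ← 𝔹 t ] d-H z s + ∑ (𝔹 t) up              ≤⟨ +-mono-≤ (∑-d-H t) ∑-up ⟩
  t * length (𝔹 t) + suc t * length (𝔹 (suc t))  ∎
  where
  open ≤-Reasoning
  𝔹 = ball F s

  upEdge? : ∀ z → Decidable (λ i → lookup z i ≡ lookup s i × flip i z ⊨ F)
  upEdge? z i = (lookup z i Bool.≟ lookup s i) ×-dec (flip i z ⊨? F)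

  up : Assignment n → ℕ
  up z = ∑[ i ← allFin n ] ⟦ upEdge? z i ⟧

  ∑-d-H : ∀ t → ∑[ z ← 𝔹 t ] d-H z s ≤ t * length (𝔹 t)
  ∑-d-H t = begin
    ∑[ z ← 𝔹 t ] d-H z s  ≤⟨ ∑-mono (𝔹 t) (λ z∈ → proj₂ (∈-ball⁻ z∈)) ⟩
    ∑[ _ ← 𝔹 t ] t        ≡⟨ ∑-const (𝔹 t) t ⟩
    length (𝔹 t) * t      ≡⟨ *-comm _ t ⟩
    t * length (𝔹 t)      ∎

  -- Every coordinate where `z` differs from `s` is charged as an inward direction, whether or not
  -- its flip is a solution.
  split : ∀ z → #neighbours F z ≤ d-H z s + up z
  split z = begin
    #neighbours F z
      ≤⟨ ∑-mono (allFin n) (λ {i} _ → ⟦⟧-≤ (flip i z ⊨? F) (edge i)) ⟩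
    ∑[ i ← allFin n ] (⟦ differs? z s i ⟧ + ⟦ upEdge? z i ⟧)  ≡⟨ ∑-+ (allFin n) ⟩
    ∑[ i ← allFin n ] ⟦ differs? z s i ⟧ + up z               ≡⟨ cong (_+ up z) (d-H-∑ z s) ⟨
    d-H z s + up z                                            ∎
    where
    edge : ∀ i → flip i z ⊨ F → 1 ≤ ⟦ differs? z s i ⟧ + ⟦ upEdge? z i ⟧
    edge i flip⊨F with lookup z i Bool.≟ lookup s i
    ... | no _    = s≤s z≤n
    ... | yes z≡s = ≤-reflexive (sym (⟦⟧-yes (yes z≡s ×-dec (flip i z ⊨? F)) (z≡s , flip⊨F)))

  up-flip : ∀ i {z} → z ∈ 𝔹 t → lookup z i ≡ lookup s i × flip i z ⊨ F →
            flip i z ∈ 𝔹 (suc t) × lookup (flip i z) i ≢ lookup s i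
  up-flip i {z} z∈ (z≡s , flip⊨F) =
    ∈-ball⁺ flip⊨F (≤-trans (d-H-flip i z s) (s≤s (proj₂ (∈-ball⁻ z∈)))) ,
    λ flip≡s → Bool.not-¬ refl (trans z≡s (trans (sym flip≡s) (Vec.lookup∘updateAt i z)))

  -- In a fixed direction `i`, outward edges inject into their far ends, which differ from `s` at
  -- `i`. Summed over `i`, a far end is counted as often as its distance from `s`, at most `suc t`.
  ∑-up : ∑ (𝔹 t) up ≤ suc t * length (𝔹 (suc t))
  ∑-up = begin
    ∑[ z ← 𝔹 t ] ∑[ i ← allFin n ] ⟦ upEdge? z i ⟧           ≡⟨ ∑-swap (𝔹 t) (allFin n) ⟩
    ∑[ i ← allFin n ] ∑[ z ← 𝔹 t ] ⟦ upEdge? z i ⟧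
      ≤⟨ ∑-mono (allFin n) (λ {i} _ →
           ∑-⟦⟧-injection (λ z → upEdge? z i) (λ w → differs? w s i)
             _≟ᵃ_ (ball-unique F s t) (flip i) (flip-injective i) (up-flip i)) ⟩
    ∑[ i ← allFin n ] ∑[ w ← 𝔹 (suc t) ] ⟦ differs? w s i ⟧  ≡⟨ ∑-swap (𝔹 (suc t)) (allFin n) ⟨
    ∑[ w ← 𝔹 (suc t) ] ∑[ i ← allFin n ] ⟦ differs? w s i ⟧  ≡⟨ ∑-cong (𝔹 (suc t)) (λ w → d-H-∑ w s) ⟨
    ∑[ w ← 𝔹 (suc t) ] d-H w s                               ≤⟨ ∑-d-H (suc t) ⟩
    suc t * length (𝔹 (suc t))                               ∎

-- Here `t` is the first radius at which doubling fails; before it each step at least doubles,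
-- starting from at least 1.
slow-growth : (V : ℕ → ℕ) → 1 ≤ V 0 → ∀ ρ →
  2 ^ ρ ≤ V ρ ⊎ ∃[ t ] (t ≤ ρ × 2 ^ t ≤ V t × V (suc t) ≤ 2 * V t)
slow-growth V 1≤V₀ zero = inj₁ 1≤V₀
slow-growth V 1≤V₀ (suc ρ) with slow-growth V 1≤V₀ ρ
... | inj₂ (t , t≤ρ , ok) = inj₂ (t , m≤n⇒m≤1+n t≤ρ , ok)
... | inj₁ 2^ρ≤V with V (suc ρ) ≤? 2 * V ρ
...   | yes slow = inj₂ (ρ , n≤1+n ρ , 2^ρ≤V , slow)
...   | no fast  = inj₁ (≤-trans (*-monoʳ-≤ 2 2^ρ≤V) (≰⇒≥ fast))

-- Weight of the solutions in a ball

#permutations : ℕ → ℕ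
#permutations n = length (permutations n)

-- For a solution `z` this is a lower bound on the number of seeds that make PPZ output `z`, by
-- `output-count` in each order.
weight : CNF n → Assignment n → ℕ
weight {n} F z = ∑[ π ← permutations n ] (2 ^ #forced F z π)

good? : (F : CNF n) → Decidable (λ (σ : Seed n) → ppz F (proj₁ σ) (proj₂ σ) ⊨ F)
good? F (y , π) = ppz F y π ⊨? F

-- A seed has a single output, so the seeds counted for different solutions are disjoint, and all of
-- them are good.
∑-weight-≤ : (F : CNF n) → ∑ (Ω F) (weight F) ≤ length (filter (good? F) (seeds n))
∑-weight-≤ {n} F = begin
  ∑[ z ← Ω F ] ∑[ π ← Π ] (2 ^ #forced F z π)
    ≤⟨ ∑-mono (Ω F) (λ z∈ → ∑-mono Π (output-count (∈-Ω⁻ z∈))) ⟩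
  ∑[ z ← Ω F ] ∑[ π ← Π ] ∑[ y ← Y ] ⟦ ppz F y π ≟ᵃ z ⟧  ≡⟨ ∑-swap (Ω F) Π ⟩
  ∑[ π ← Π ] ∑[ z ← Ω F ] ∑[ y ← Y ] ⟦ ppz F y π ≟ᵃ z ⟧  ≡⟨ ∑-cong Π (λ π → ∑-swap (Ω F) Y) ⟩
  ∑[ π ← Π ] ∑[ y ← Y ] ∑[ z ← Ω F ] ⟦ ppz F y π ≟ᵃ z ⟧  ≡⟨ ∑-swap Π Y ⟩
  ∑[ y ← Y ] ∑[ π ← Π ] ∑[ z ← Ω F ] ⟦ ppz F y π ≟ᵃ z ⟧
    ≤⟨ ∑-mono Y (λ {y} _ → ∑-mono Π (λ {π} _ → fibres y π)) ⟩
  ∑[ y ← Y ] ∑[ π ← Π ] ⟦ good? F (y , π) ⟧              ≡⟨ ∑-cartesianProductWith Y Π ⟨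
  ∑[ σ ← seeds n ] ⟦ good? F σ ⟧                         ≡⟨ length-filter-∑ (good? F) (seeds n) ⟨
  length (filter (good? F) (seeds n))                    ∎
  where
  open ≤-Reasoning
  Π = permutations n
  Y = assignments n

  fibres : ∀ y π → ∑[ z ← Ω F ] ⟦ ppz F y π ≟ᵃ z ⟧ ≤ ⟦ good? F (y , π) ⟧
  fibres y π with good? F (y , π)
  ... | yes _  = ∑-⟦⟧-atMostOne (ppz F y π ≟ᵃ_) (Ω-unique F) λ _ _ u≡z u≡z′ → trans (sym u≡z) u≡z′
  ... | no u⊭F = ≤-reflexive (∑-⟦⟧-none (ppz F y π ≟ᵃ_) (All.tabulate λ z∈ u≡z →
                   u⊭F (subst (_⊨ F) (sym u≡z) (∈-Ω⁻ z∈))))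

-- 2^(f-m) ≥ 1 + (f-m), the tangent inequality standing in for the convexity of 2^f,
-- with both sides moved so that no subtraction occurs.
2^m*1+f≤2^f+m*2^m : ∀ m f → 2 ^ m * suc f ≤ 2 ^ f + m * 2 ^ m
2^m*1+f≤2^f+m*2^m m f with m ≤? f
... | no m≰f = begin
  2 ^ m * suc f      ≤⟨ *-monoʳ-≤ (2 ^ m) (≰⇒> m≰f) ⟩
  2 ^ m * m          ≡⟨ *-comm (2 ^ m) m ⟩
  m * 2 ^ m          ≤⟨ m≤n+m _ (2 ^ f) ⟩
  2 ^ f + m * 2 ^ m  ∎
  where open ≤-Reasoning
... | yes m≤f with j , refl ← m≤n⇒∃[o]m+o≡n m≤f = begin
  2 ^ m * suc (m + j)        ≡⟨ cong (2 ^ m *_) (sym (+-suc m j)) ⟩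
  2 ^ m * (m + suc j)        ≤⟨ *-monoʳ-≤ (2 ^ m) (+-monoʳ-≤ m (n<2^n j)) ⟩
  2 ^ m * (m + 2 ^ j)        ≡⟨ distrib (2 ^ m) (2 ^ j) m ⟩
  2 ^ m * 2 ^ j + m * 2 ^ m  ≡⟨ cong (_+ m * 2 ^ m) (^-distribˡ-+-* 2 m j) ⟨
  2 ^ (m + j) + m * 2 ^ m    ∎
  where
  open ≤-Reasoning
  distrib : ∀ a b c → a * (c + b) ≡ a * b + c * a
  distrib = solve-∀

  n<2^n : ∀ j → suc j ≤ 2 ^ j
  n<2^n zero    = ≤-refl
  n<2^n (suc j) = begin
    suc (suc j)    ≤⟨ s≤s (n<2^n j) ⟩
    1 + 2 ^ j      ≤⟨ +-monoˡ-≤ (2 ^ j) (m^n>0 2 j) ⟩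
    2 ^ j + 2 ^ j  ≡⟨ cong (2 ^ j +_) (+-identityʳ (2 ^ j)) ⟨
    2 * 2 ^ j      ∎

-- Jensen's inequality for `2 ^ f` at an integer `m` not above the average: the tangent inequality
-- at `m` is summed, and the accumulated `L * (m * 2 ^ m)` cancels.
∑-2^-≥ : ∀ (xs : List A) m {f : A → ℕ} → m * length xs ≤ ∑ xs f →
         2 ^ m * length xs ≤ ∑[ x ← xs ] (2 ^ f x)
∑-2^-≥ xs m {f} m≤avg = +-cancelʳ-≤ (length xs * (m * 2 ^ m)) _ _ (begin
  2 ^ m * L + L * (m * 2 ^ m)              ≡⟨ factor (2 ^ m) L m ⟩
  2 ^ m * (L + m * L)                      ≤⟨ *-monoʳ-≤ (2 ^ m) (+-monoʳ-≤ L m≤avg) ⟩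
  2 ^ m * (L + ∑ xs f)                     ≡⟨ cong (λ l → 2 ^ m * (l + ∑ xs f)) (∑-1 xs) ⟨
  2 ^ m * (∑ xs (λ _ → 1) + ∑ xs f)        ≡⟨ cong (2 ^ m *_) (∑-+ xs) ⟨
  2 ^ m * ∑ xs (λ x → suc (f x))           ≡⟨ ∑-* xs (2 ^ m) ⟨
  ∑[ x ← xs ] (2 ^ m * suc (f x))          ≤⟨ ∑-mono xs (λ {x} _ → 2^m*1+f≤2^f+m*2^m m (f x)) ⟩
  ∑[ x ← xs ] (2 ^ f x + m * 2 ^ m)        ≡⟨ ∑-+ xs ⟩
  ∑[ x ← xs ] (2 ^ f x) + ∑[ _ ← xs ] (m * 2 ^ m)
    ≡⟨ cong (∑[ x ← xs ] (2 ^ f x) +_) (∑-const xs (m * 2 ^ m)) ⟩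
  ∑[ x ← xs ] (2 ^ f x) + L * (m * 2 ^ m)  ∎)
  where
  open ≤-Reasoning
  L = length xs
  factor : ∀ a l m → a * l + l * (m * a) ≡ a * (l + m * l)
  factor = solve-∀

#pairs : (xs : List A) (n : ℕ) → length (cartesianProduct xs (permutations n)) ≡ #permutations n * length xs
#pairs xs n = trans (length-cartesianProductWith _,_ xs (permutations n)) (*-comm (length xs) _)

-- For each `i`, either the flip is a solution, and `i` counts as a neighbour in all orders, or
-- `forced-count` applies; both cases are added up over `i`.
∑-forced-≥ : ∀ {k} {F : CNF n} z → IsKCNF k F → z ⊨ F →
  #permutations n * n ≤ k * (∑[ π ← permutations n ] #forced F z π) + #permutations n * #neighbours F z
∑-forced-≥ {n} {k} {F} z kcnf z⊨F = begin
  n! * n                                                              ≡⟨ *-comm n! n ⟩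
  n * n!
    ≡⟨ cong (_* n!) (List.length-tabulate (id {A = Fin n})) ⟨
  length (allFin n) * n!                                              ≡⟨ ∑-const (allFin n) n! ⟨
  ∑[ _ ← allFin n ] n!
    ≤⟨ ∑-mono (allFin n) (λ {i} _ → step i) ⟩
  ∑[ i ← allFin n ] (k * forcing i + n! * ⟦ flip i z ⊨? F ⟧)          ≡⟨ ∑-+ (allFin n) ⟩
  ∑[ i ← allFin n ] (k * forcing i) + ∑[ i ← allFin n ] (n! * ⟦ flip i z ⊨? F ⟧)
    ≡⟨ cong₂ _+_ (∑-* (allFin n) k) (∑-* (allFin n) n!) ⟩
  k * ∑ (allFin n) forcing + n! * #neighbours F z
    ≡⟨ cong (λ x → k * x + n! * #neighbours F z) (∑-swap (allFin n) (permutations n)) ⟩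
  k * (∑[ π ← permutations n ] #forced F z π) + n! * #neighbours F z  ∎
  where
  open ≤-Reasoning
  n! = #permutations n
  forcing : Fin n → ℕ
  forcing i = ∑[ π ← permutations n ] ⟦ forced? F z π i ⟧

  step : ∀ i → n! ≤ k * forcing i + n! * ⟦ flip i z ⊨? F ⟧
  step i with flip i z ⊨? F
  ... | yes _      = ≤-trans (≤-reflexive (sym (*-identityʳ n!))) (m≤n+m _ _)
  ... | no flip⊭F  = ≤-trans (forced-count z kcnf z⊨F flip⊭F) (m≤m+n _ _)

-- Jensen is applied to the pairs of a solution in the ball and an order, over which slow growth
-- makes the average number of forced variables at least `(n - (3t + 2)) / k`.
slow-ball-weight : ∀ {k} .{{_ : NonZero k}} {F : CNF n} {s t} → IsKCNF k F →
  length (ball F s (suc t)) ≤ 2 * length (ball F s t) →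
  2 ^ ((n ∸ (3 * t + 2)) / k) * (#permutations n * length (ball F s t)) ≤ ∑ (ball F s t) (weight F)
slow-ball-weight {n} {k} {F} {s} {t} kcnf slow = begin
  2 ^ m′ * (n! * V)                      ≡⟨ cong (2 ^ m′ *_) (#pairs 𝔹 n) ⟨
  2 ^ m′ * length 𝔹Π                     ≤⟨ ∑-2^-≥ 𝔹Π m′ (*-cancelˡ-≤ k average) ⟩
  ∑[ (z , π) ← 𝔹Π ] (2 ^ #forced F z π)  ≡⟨ ∑-cartesianProductWith 𝔹 Π ⟩
  ∑ 𝔹 (weight F)                         ∎
  where
  open ≤-Reasoning
  Π = permutations n
  n! = #permutations n
  𝔹 = ball F s t
  V = length 𝔹
  𝔹Π = cartesianProduct 𝔹 Π
  m′ = (n ∸ (3 * t + 2)) / k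
  φ : Assignment n → ℕ
  φ z = ∑[ π ← Π ] #forced F z π

  neighbours : ∑ 𝔹 (#neighbours F) ≤ (3 * t + 2) * V
  neighbours = begin
    ∑ 𝔹 (#neighbours F)                        ≤⟨ ball-neighbours F s t ⟩
    t * V + suc t * length (ball F s (suc t))  ≤⟨ +-monoʳ-≤ (t * V) (*-monoʳ-≤ (suc t) slow) ⟩
    -- The `3t + 2` is `t` for inward directions plus `2(t + 1)` for outward ones, with the growth
    -- factor 2.
    t * V + suc t * (2 * V)                    ≡⟨ collect t V ⟩
    (3 * t + 2) * V                            ∎
    where
    collect : ∀ t V → t * V + (1 + t) * (2 * V) ≡ (3 * t + 2) * V
    collect = solve-∀

  total : (n! * V) * n ≤ (n! * V) * (3 * t + 2) + k * ∑ 𝔹 φ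
  total = begin
    (n! * V) * n                                              ≡⟨ rearrange n! V n ⟩
    V * (n! * n)                                              ≡⟨ ∑-const 𝔹 (n! * n) ⟨
    ∑[ _ ← 𝔹 ] (n! * n)
      ≤⟨ ∑-mono 𝔹 (λ {z} z∈ → ∑-forced-≥ z kcnf (proj₁ (∈-ball⁻ z∈))) ⟩
    ∑[ z ← 𝔹 ] (k * φ z + n! * #neighbours F z)               ≡⟨ ∑-+ 𝔹 ⟩
    ∑[ z ← 𝔹 ] (k * φ z) + ∑[ z ← 𝔹 ] (n! * #neighbours F z)  ≡⟨ cong₂ _+_ (∑-* 𝔹 k) (∑-* 𝔹 n!) ⟩
    k * ∑ 𝔹 φ + n! * ∑ 𝔹 (#neighbours F)
      ≤⟨ +-monoʳ-≤ (k * ∑ 𝔹 φ) (*-monoʳ-≤ n! neighbours) ⟩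
    k * ∑ 𝔹 φ + n! * ((3 * t + 2) * V)                        ≡⟨ regroup (k * ∑ 𝔹 φ) n! (3 * t + 2) V ⟩
    (n! * V) * (3 * t + 2) + k * ∑ 𝔹 φ                        ∎
    where
    rearrange : ∀ n! V n → (n! * V) * n ≡ V * (n! * n)
    rearrange = solve-∀
    regroup : ∀ a n! c V → a + n! * (c * V) ≡ (n! * V) * c + a
    regroup = solve-∀

  average : k * (m′ * length 𝔹Π) ≤ k * (∑[ (z , π) ← 𝔹Π ] #forced F z π)
  average = begin
    k * (m′ * length 𝔹Π)                   ≡⟨ cong (λ l → k * (m′ * l)) (#pairs 𝔹 n) ⟩
    k * (m′ * (n! * V))                    ≡⟨ rearrange k m′ (n! * V) ⟩
    (n! * V) * (m′ * k)                    ≤⟨ *-monoʳ-≤ (n! * V) (m/n*n≤m (n ∸ (3 * t + 2)) k) ⟩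
    -- If `3t + 2` exceeds `n`, the truncated difference and `m′` are 0 and the bound is trivial.
    (n! * V) * (n ∸ (3 * t + 2))           ≡⟨ *-distribˡ-∸ (n! * V) n (3 * t + 2) ⟩
    (n! * V) * n ∸ (n! * V) * (3 * t + 2)  ≤⟨ m≤n+o⇒m∸n≤o _ _ total ⟩
    k * ∑ 𝔹 φ                              ≡⟨ cong (k *_) (∑-cartesianProductWith 𝔹 Π) ⟨
    k * (∑[ (z , π) ← 𝔹Π ] #forced F z π)  ∎
    where
    rearrange : ∀ k m x → k * (m * x) ≡ x * (m * k)
    rearrange = solve-∀

∑-ball-mono : ∀ (F : CNF n) s {t ρ} → t ≤ ρ → ∀ {f} → ∑ (ball F s t) f ≤ ∑ (ball F s ρ) f
∑-ball-mono F s {t} {ρ} t≤ρ {f} = begin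
  ∑ (ball F s t) f                       ≡⟨ ∑-filter (λ z → d-H z s ≤? t) (Ω F) ⟩
  ∑[ z ← Ω F ] (⟦ d-H z s ≤? t ⟧ * f z)
    ≤⟨ ∑-mono (Ω F) (λ {z} _ → *-monoˡ-≤ (f z)
         (⟦⟧-mono (d-H z s ≤? t) (d-H z s ≤? ρ) (λ z≤t → ≤-trans z≤t t≤ρ))) ⟩
  ∑[ z ← Ω F ] (⟦ d-H z s ≤? ρ ⟧ * f z)  ≡⟨ ∑-filter (λ z → d-H z s ≤? ρ) (Ω F) ⟨
  ∑ (ball F s ρ) f                       ∎
  where open ≤-Reasoning

#permutations≤weight : ∀ (F : CNF n) z → #permutations n ≤ weight F z
#permutations≤weight {n} F z = begin
  #permutations n            ≡⟨ ∑-1 (permutations n) ⟨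
  ∑[ _ ← permutations n ] 1  ≤⟨ ∑-mono (permutations n) (λ {π} _ → m^n>0 2 (#forced F z π)) ⟩
  weight F z                 ∎
  where open ≤-Reasoning

-- This is where `3 ≤ k` enters: taking `3t` from the numerator costs about `t` at most, which the
-- added `t` repays; it stands for the `2 ^ t` solutions in the ball. The remaining 2 and the
-- rounding cost at most the 1 subtracted on the left.
n/k∸1≤ : ∀ n {k} .{{_ : NonZero k}} t → 3 ≤ k → n / k ∸ 1 ≤ (n ∸ (3 * t + 2)) / k + t
n/k∸1≤ n {k} t 3≤k = m≤n+o⇒m∸n≤o _ 1 (s≤s⁻¹ (m<n*o⇒m/o<n (begin-strict
  n                                  ≤⟨ m≤n+m∸n n (3 * t + 2) ⟩
  (3 * t + 2) + x                    ≡⟨ cong ((3 * t + 2) +_) (m≡m%n+[m/n]*n x k) ⟩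
  (3 * t + 2) + (x % k + x / k * k)  <⟨ +-mono-≤-< bound (+-monoˡ-< (x / k * k) (m%n<n x k)) ⟩
  (t + 1) * k + (k + x / k * k)      ≡⟨ collect t k (x / k) ⟩
  suc (1 + (x / k + t)) * k          ∎)))
  where
  open ≤-Reasoning
  x = n ∸ (3 * t + 2)
  bound : 3 * t + 2 ≤ (t + 1) * k
  bound = begin
    3 * t + 2    ≤⟨ +-monoʳ-≤ (3 * t) (n≤1+n 2) ⟩
    3 * t + 3    ≡⟨ expand t ⟩
    (t + 1) * 3  ≤⟨ *-monoʳ-≤ (t + 1) 3≤k ⟩
    (t + 1) * k  ∎
    where
    expand : ∀ t → 3 * t + 3 ≡ (t + 1) * 3
    expand = solve-∀
  collect : ∀ t k q → (t + 1) * k + (k + q * k) ≡ (2 + (q + t)) * k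
  collect = solve-∀

heavy-ball : ∀ {k} .{{_ : NonZero k}} {F : CNF n} {s} ρ → 3 ≤ k → IsKCNF k F → s ⊨ F →
  n / k ∸ 1 ≤ ρ → #permutations n * 2 ^ (n / k ∸ 1) ≤ ∑ (ball F s ρ) (weight F)
heavy-ball {n} {k} {F} {s} ρ 3≤k kcnf s⊨F e≤ρ
  with slow-growth (length ∘ ball F s) s∈B₀ ρ
  where
  open ≤-Reasoning
  s∈B₀ : 1 ≤ length (ball F s 0)
  s∈B₀ = begin
    1                      ≤⟨ ∈⇒≤∑ {x = s} {f = λ _ → 1} (∈-ball⁺ s⊨F (≤-reflexive (d-H-refl s))) ⟩
    ∑[ _ ← ball F s 0 ] 1  ≡⟨ ∑-1 (ball F s 0) ⟩
    length (ball F s 0)    ∎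
-- Doubling lasts up to `ρ`: the number of solutions suffices, each counted only once per order.
... | inj₁ 2^ρ≤V = begin
  n! * 2 ^ (n / k ∸ 1)       ≤⟨ *-monoʳ-≤ n! (^-monoʳ-≤ 2 e≤ρ) ⟩
  n! * 2 ^ ρ                 ≤⟨ *-monoʳ-≤ n! 2^ρ≤V ⟩
  n! * length (ball F s ρ)   ≡⟨ *-comm n! _ ⟩
  length (ball F s ρ) * n!   ≡⟨ ∑-const (ball F s ρ) n! ⟨
  ∑[ _ ← ball F s ρ ] n!     ≤⟨ ∑-mono (ball F s ρ) (λ {z} _ → #permutations≤weight F z) ⟩
  ∑ (ball F s ρ) (weight F)  ∎
  where
  open ≤-Reasoning
  n! = #permutations n
-- Doubling stops at `t`: at least `2 ^ t` solutions, of average weight at least `2 ^ g` per order.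
... | inj₂ (t , t≤ρ , 2^t≤V , slow) = begin
  n! * 2 ^ (n / k ∸ 1)                ≤⟨ *-monoʳ-≤ n! (^-monoʳ-≤ 2 (n/k∸1≤ n t 3≤k)) ⟩
  n! * 2 ^ (g + t)                    ≡⟨ cong (n! *_) (^-distribˡ-+-* 2 g t) ⟩
  n! * (2 ^ g * 2 ^ t)                ≤⟨ *-monoʳ-≤ n! (*-monoʳ-≤ (2 ^ g) 2^t≤V) ⟩
  n! * (2 ^ g * length (ball F s t))  ≡⟨ rearrange n! (2 ^ g) _ ⟩
  2 ^ g * (n! * length (ball F s t))  ≤⟨ slow-ball-weight {F = F} {s} {t} kcnf slow ⟩
  ∑ (ball F s t) (weight F)           ≤⟨ ∑-ball-mono F s t≤ρ ⟩
  ∑ (ball F s ρ) (weight F)           ∎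
  where
  open ≤-Reasoning
  n! = #permutations n
  g = (n ∸ (3 * t + 2)) / k
  rearrange : ∀ n! g v → n! * (g * v) ≡ g * (n! * v)
  rearrange = solve-∀

-- Packing disjoint balls

minimum-≤ : ∀ {r ds d} → [ r ] ≤⁺ minimum ds → d ∈ ds → r ≤ d
minimum-≤ {ds = d₀ ∷ ds} [ r≤min ] (here refl)  = ≤-trans r≤min (min≤⊤ d₀ ds)
minimum-≤ {ds = d₀ ∷ ds} [ r≤min ] (there d∈ds) = ≤-trans r≤min (All.lookup (min≤xs d₀ ds) d∈ds)

minPD-≤ : ∀ {r} {S : List (Assignment n)} {s t} → [ r ] ≤⁺ minPD S → s ∈ S → t ∈ S → s ≢ t → r ≤ d-H s t
minPD-≤ r≤minPD s∈ t∈ s≢t =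
  minimum-≤ r≤minPD (∈-map⁺ (uncurry d-H) (∈-filter⁺ _ (∈-cartesianProduct⁺ s∈ t∈) s≢t))

sublists-All : ∀ {P : Pred A ℓ} {xs ys} → All P xs → ys ∈ sublists xs → All P ys
sublists-All []         (here refl) = []
sublists-All {xs = x ∷ xs} (px ∷ pxs) ys∈ with ∈-++⁻ (map (x ∷_) (sublists xs)) ys∈
... | inj₂ ys∈′ = sublists-All pxs ys∈′
... | inj₁ ys∈′ with _ , zs∈ , refl ← ∈-map⁻ (x ∷_) ys∈′ = px ∷ sublists-All pxs zs∈

sublists-unique : ∀ {xs ys : List A} → Unique xs → ys ∈ sublists xs → Unique ys
sublists-unique []         (here refl) = []
sublists-unique {xs = x ∷ xs} (x∉ ∷ xs!) ys∈ with ∈-++⁻ (map (x ∷_) (sublists xs)) ys∈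
... | inj₂ ys∈′ = sublists-unique xs! ys∈′
... | inj₁ ys∈′ with _ , zs∈ , refl ← ∈-map⁻ (x ∷_) ys∈′ = sublists-All x∉ zs∈ ∷ sublists-unique xs! zs∈

-- For r = 0 truncated subtraction makes ρ = 0, and balls of radius 0 are points.
balls-disjoint : ∀ {r ρ} {S : List (Assignment n)} {s t} z → ρ + ρ ≤ r ∸ 1 → [ r ] ≤⁺ minPD S →
  s ∈ S → t ∈ S → d-H z s ≤ ρ → d-H z t ≤ ρ → s ≡ t
balls-disjoint {r = r} {ρ} {s = s} {t} z ρ+ρ<r r≤minPD s∈ t∈ zs≤ρ zt≤ρ = decidable-stable (s ≟ᵃ t) λ s≢t →
  s≢t (d-H≡0⇒≡ s t (collapse r (minPD-≤ r≤minPD s∈ t∈ s≢t) d≤r∸1))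
  where
  d≤r∸1 : d-H s t ≤ r ∸ 1
  d≤r∸1 = ≤-trans (d-H-triangle z s t) (≤-trans (+-mono-≤ zs≤ρ zt≤ρ) ρ+ρ<r)

  collapse : ∀ r {d} → r ≤ d → d ≤ r ∸ 1 → d ≡ 0
  collapse zero    _   d≤0 = n≤0⇒n≡0 d≤0
  collapse (suc r) r<d d≤r = contradiction (≤-trans r<d d≤r) 1+n≰n

-- Around the points of a separated set `S` the balls are disjoint, so every solution lies in at
-- most one of them and its weight is counted at most once.
packing : ∀ {c r ρ} (F : CNF n) (w : Assignment n → ℕ) → ρ + ρ ≤ r ∸ 1 →
  (∀ {s} → s ⊨ F → c ≤ ∑ (ball F s ρ) w) → N F r * c ≤ ∑ (Ω F) w
packing {n} {c} {r} {ρ} F w ρ+ρ<r c≤ball =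
  -- `N` is a maximum with default 0, so the bound is checked for 0 and for the size of every
  -- separated set.
  argmax-all id {P = λ l → l * c ≤ ∑ (Ω F) w} z≤n (All.map⁺ (All.tabulate λ S∈ →
    let S∈sub , separated = ∈-filter⁻ _ {xs = sublists (Ω F)} S∈ in
    bound (sublists-unique (Ω-unique F) S∈sub) (sublists-All (All.tabulate ∈-Ω⁻) S∈sub) separated))
  where
  open ≤-Reasoning
  bound : ∀ {S} → Unique S → All (_⊨ F) S → [ r ] ≤⁺ minPD S → length S * c ≤ ∑ (Ω F) w
  bound {S} S! S⊨F r≤minPD = begin
    length S * c                                      ≡⟨ ∑-const S c ⟨
    ∑[ _ ← S ] c                                      ≤⟨ ∑-mono S (λ s∈ → c≤ball (All.lookup S⊨F s∈)) ⟩
    ∑[ s ← S ] ∑ (ball F s ρ) w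
      ≡⟨ ∑-cong S (λ s → ∑-filter (λ z → d-H z s ≤? ρ) (Ω F)) ⟩
    ∑[ s ← S ] ∑[ z ← Ω F ] (⟦ d-H z s ≤? ρ ⟧ * w z)  ≡⟨ ∑-swap S (Ω F) ⟩
    ∑[ z ← Ω F ] ∑[ s ← S ] (⟦ d-H z s ≤? ρ ⟧ * w z)
      ≡⟨ ∑-cong (Ω F) (λ z → ∑-cong S (λ s → *-comm ⟦ d-H z s ≤? ρ ⟧ (w z))) ⟩
    ∑[ z ← Ω F ] ∑[ s ← S ] (w z * ⟦ d-H z s ≤? ρ ⟧)  ≡⟨ ∑-cong (Ω F) (λ z → ∑-* S (w z)) ⟩
    ∑[ z ← Ω F ] (w z * (∑[ s ← S ] ⟦ d-H z s ≤? ρ ⟧))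
      ≤⟨ ∑-mono (Ω F) (λ {z} _ → *-monoʳ-≤ (w z)
           (∑-⟦⟧-atMostOne (λ s → d-H z s ≤? ρ) S! (balls-disjoint z ρ+ρ<r r≤minPD))) ⟩
    ∑[ z ← Ω F ] (w z * 1)                            ≡⟨ ∑-cong (Ω F) (λ z → *-identityʳ (w z)) ⟩
    ∑ (Ω F) w                                         ∎

goodSeeds-≥ : ∀ {k} .{{_ : NonZero k}} (F : CNF n) → 3 ≤ k → IsKCNF k F →
  N F ((2 * n) / k) * (#permutations n * 2 ^ (n / k ∸ 1)) ≤ length (filter (good? F) (seeds n))
goodSeeds-≥ {n} {k} F 3≤k kcnf =
  ≤-trans (packing F (weight F) ρ+ρ≤r∸1 (λ s⊨F → heavy-ball ρ 3≤k kcnf s⊨F ≤-refl)) (∑-weight-≤ F)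
  where
  open ≤-Reasoning
  -- The radius must reach the exponent in `heavy-ball`, while its double stays within
  -- `(2 * n) / k ∸ 1`; the latter holds because `2⌊n/k⌋ ≤ ⌊2n/k⌋`.
  ρ = n / k ∸ 1
  ρ+ρ≤r∸1 : ρ + ρ ≤ (2 * n) / k ∸ 1
  ρ+ρ≤r∸1 = begin
    (n / k ∸ 1) + (n / k ∸ 1)  ≤⟨ double (n / k) ⟩
    2 * (n / k) ∸ 1            ≡⟨ cong (_∸ 1) (m*n/n≡m (2 * (n / k)) k) ⟨
    2 * (n / k) * k / k ∸ 1    ≡⟨ cong (λ x → x / k ∸ 1) (*-assoc 2 (n / k) k) ⟩
    2 * (n / k * k) / k ∸ 1    ≤⟨ ∸-monoˡ-≤ 1 (/-monoˡ-≤ k (*-monoʳ-≤ 2 (m/n*n≤m n k))) ⟩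
    (2 * n) / k ∸ 1            ∎
    where
    double : ∀ q → (q ∸ 1) + (q ∸ 1) ≤ 2 * q ∸ 1
    double zero    = z≤n
    double (suc q) = +-monoʳ-≤ q (≤-trans (n≤1+n q) (m≤m+n _ 0))

-- Independent repetitions

length-vectors : ∀ (xs : List A) T → length (vectors xs T) ≡ length xs ^ T
length-vectors xs zero    = refl
length-vectors xs (suc T) =
  trans (length-cartesianProductWith _∷_ xs (vectors xs T)) (cong (length xs *_) (length-vectors xs T))

module _ {q} {Q : Pred A q} (Q? : Decidable Q) (xs : List A) where

  #failures : ℕ
  #failures = ∑[ x ← xs ] ⟦ ¬? (Q? x) ⟧

  #successes+#failures : length (filter Q? xs) + #failures ≡ length xs
  #successes+#failures = begin
    length (filter Q? xs) + #failures       ≡⟨ cong (_+ #failures) (length-filter-∑ Q? xs) ⟩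
    ∑[ x ← xs ] ⟦ Q? x ⟧ + #failures        ≡⟨ ∑-+ xs ⟨
    ∑[ x ← xs ] (⟦ Q? x ⟧ + ⟦ ¬? (Q? x) ⟧)  ≡⟨ ∑-cong xs (λ x → one (Q? x)) ⟩
    ∑[ _ ← xs ] 1                           ≡⟨ ∑-1 xs ⟩
    length xs                               ∎
    where
    open ≡-Reasoning
    one : ∀ {p} {P : Set p} (P? : Dec P) → ⟦ P? ⟧ + ⟦ ¬? P? ⟧ ≡ 1
    one (yes _) = refl
    one (no _)  = refl

  -- Complementary counting: a tuple without success consists of failures only, and there are
  -- `#failures ^ T` of those.
  any-count : ∀ T → length (filter (VecAny.any? Q?) (vectors xs T)) + #failures ^ T ≡ length xs ^ T
  any-count T = trans (cong (_+ #failures ^ T) (length-filter-∑ (VecAny.any? Q?) (vectors xs T))) (∑-any T)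
    where
    open ≡-Reasoning
    ∑-any : ∀ T → ∑[ v ← vectors xs T ] ⟦ VecAny.any? Q? v ⟧ + #failures ^ T ≡ length xs ^ T
    -- Conditioning on the first entry: a success makes every tail count, a failure leaves the
    -- question to the tail.
    extend : ∀ T x → ∑[ v ← vectors xs T ] ⟦ VecAny.any? Q? (x ∷ v) ⟧ + #failures ^ T * ⟦ ¬? (Q? x) ⟧
                     ≡ length xs ^ T

    extend T x with Q? x
    ... | no _  = trans (cong (∑ (vectors xs T) (⟦_⟧ ∘ VecAny.any? Q?) +_) (*-identityʳ _)) (∑-any T)
    ... | yes _ = trans (cong₂ _+_ (∑-1 (vectors xs T)) (*-zeroʳ (#failures ^ T)))
                    (trans (+-identityʳ _) (length-vectors xs T))

    ∑-any zero    = refl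
    ∑-any (suc T) = begin
      ∑[ v ← vectors xs (suc T) ] ⟦ VecAny.any? Q? v ⟧ + #failures * #failures ^ T
        ≡⟨ cong₂ _+_ (∑-cartesianProductWith xs (vectors xs T))
                     (trans (*-comm #failures _) (sym (∑-* xs (#failures ^ T)))) ⟩
      ∑[ x ← xs ] ∑[ v ← vectors xs T ] ⟦ VecAny.any? Q? (x ∷ v) ⟧ + ∑[ x ← xs ] (#failures ^ T * ⟦ ¬? (Q? x) ⟧)
        ≡⟨ ∑-+ xs ⟨
      ∑[ x ← xs ] (∑[ v ← vectors xs T ] ⟦ VecAny.any? Q? (x ∷ v) ⟧ + #failures ^ T * ⟦ ¬? (Q? x) ⟧)
        ≡⟨ ∑-cong xs (extend T) ⟩
      ∑[ _ ← xs ] (length xs ^ T)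
        ≡⟨ ∑-const xs _ ⟩
      length xs * length xs ^ T  ∎

-- Bernoulli's inequality for `(1 + q/b) ^ T`, multiplied by `b ^ suc T`.
bernoulli : ∀ b q T → b ^ T * (b + T * q) ≤ b * (q + b) ^ T
bernoulli b q zero    = ≤-reflexive (base b)
  where
  base : ∀ b → 1 * (b + 0) ≡ b * 1
  base = solve-∀
bernoulli b q (suc T) = begin
  b * b ^ T * (b + (q + T * q))                        ≤⟨ m≤m+n _ (b ^ T * (T * q * q)) ⟩
  b * b ^ T * (b + (q + T * q)) + b ^ T * (T * q * q)  ≡⟨ expand b (b ^ T) q (T * q) ⟩
  (q + b) * (b ^ T * (b + T * q))                      ≤⟨ *-monoʳ-≤ (q + b) (bernoulli b q T) ⟩
  (q + b) * (b * (q + b) ^ T)                          ≡⟨ rearrange (q + b) b ((q + b) ^ T) ⟩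
  b * ((q + b) * (q + b) ^ T)                          ∎
  where
  open ≤-Reasoning
  expand : ∀ b x q s → b * x * (b + (q + s)) + x * (s * q) ≡ (q + b) * (x * (b + s))
  expand = solve-∀
  rearrange : ∀ l b x → l * (b * x) ≡ b * (l * x)
  rearrange = solve-∀

-- By Bernoulli, `((q + b) / b) ^ T ≥ 1 + T q / b ≥ 1 + n`. In terms of probability, `T` trials with
-- at least `n` expected successes all fail with probability at most `1 / (n + 1)`.
failure-bound : ∀ n b q T → 1 ≤ q → n * (q + b) ≤ T * q → suc n * b ^ T ≤ (q + b) ^ T
-- The division by `b` excludes 0, which is treated separately. With no trials, `1 ≤ q` leaves only
-- `n = 0`.
failure-bound n zero q zero 1≤q nL≤0 with m*n≡0⇒m≡0∨n≡0 n (n≤0⇒n≡0 nL≤0)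
... | inj₁ refl = ≤-refl
... | inj₂ q≡0  = contradiction (trans (sym (+-identityʳ q)) q≡0) (>⇒≢ 1≤q)
failure-bound n zero q (suc T) _ _ = ≤-trans (≤-reflexive (*-zeroʳ (suc n))) z≤n
failure-bound n b@(suc _) q T _ nL≤Tq = *-cancelˡ-≤ b (begin
  b * (suc n * b ^ T)  ≡⟨ rearrange b n (b ^ T) ⟩
  b ^ T * (b + n * b)  ≤⟨ *-monoʳ-≤ (b ^ T) (+-monoʳ-≤ b (≤-trans (*-monoʳ-≤ n (m≤n+m b q)) nL≤Tq)) ⟩
  b ^ T * (b + T * q)  ≤⟨ bernoulli b q T ⟩
  b * (q + b) ^ T      ∎)
  where
  open ≤-Reasoning
  rearrange : ∀ b n x → b * ((1 + n) * x) ≡ x * (b + n * b)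
  rearrange = solve-∀

-- `mkℚᵘ` stores the denominator minus one, so this is `1 / (n + 1)`.
ε : ℕ → ℚᵘ
ε n = mkℚᵘ (ℤ.+ 1) n

ε-tendsToZero : TendsToZero ε
ε-tendsToZero (mkℚᵘ (ℤ.+ zero)  d) (*<* (ℤ.+<+ ()))
ε-tendsToZero (mkℚᵘ -[1+ _ ]    d) (*<* ())
ε-tendsToZero (mkℚᵘ (ℤ.+ suc p) d) _ = suc d , λ n d<n → *<* (ℤ.+<+ (begin-strict
  suc (d + 0)    ≡⟨ cong suc (+-identityʳ d) ⟩
  suc d          ≤⟨ d<n ⟩
  n              <⟨ n<1+n n ⟩
  suc n          ≤⟨ m≤m+n (suc n) (p * suc n) ⟩
  suc p * suc n  ∎))
  where open ≤-Reasoning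

1-ε≤ : ∀ n s M → 1 ≤ M → n * M ≤ s * suc n → 1ℚᵘ ℚᵘ.- ε n ℚᵘ.≤ s /₀ M
1-ε≤ n s (suc M) _ nM≤sn = *≤* (subst₂ ℤ._≤_ (ℤ.pos-* (n + 0) (suc M)) (ℤ.pos-* s (suc n + 0))
  (ℤ.+≤+ (subst (λ x → x * suc M ≤ s * suc x) (sym (+-identityʳ n)) nM≤sn)))

-- Complementary counting turns `failure-bound` into a success probability: the hypothesis asks for
-- `n` expected successes among `T` draws.
amplification : ∀ {q} {Q : Pred A q} (Q? : Decidable Q) (xs : List A) n T →
  1 ≤ length (filter Q? xs) → n * length xs ≤ T * length (filter Q? xs) →
  1ℚᵘ ℚᵘ.- ε n ℚᵘ.≤ Pr (VecAny.any? Q?) (vectors xs T)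
amplification Q? xs n T 1≤q nL≤Tq = 1-ε≤ n s (length (vectors xs T)) 1≤M (+-cancelʳ-≤ M _ _ (begin
  n * M + M            ≡⟨ +-comm (n * M) M ⟩
  suc n * M            ≡⟨ cong (suc n *_) s+f ⟨
  suc n * (s + b ^ T)  ≡⟨ *-distribˡ-+ (suc n) s (b ^ T) ⟩
  suc n * s + suc n * b ^ T
    ≤⟨ +-monoʳ-≤ (suc n * s) (failure-bound n b q T 1≤q
         (subst (λ l → n * l ≤ T * q) (sym q+b) nL≤Tq)) ⟩
  suc n * s + (q + b) ^ T
    ≡⟨ cong₂ _+_ (*-comm (suc n) s) (trans (cong (_^ T) q+b) (sym (length-vectors xs T))) ⟩
  s * suc n + M        ∎))
  where
  open ≤-Reasoning
  q = length (filter Q? xs)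
  b = #failures Q? xs
  s = length (filter (VecAny.any? Q?) (vectors xs T))
  M = length (vectors xs T)
  q+b : q + b ≡ length xs
  q+b = #successes+#failures Q? xs
  s+f : s + b ^ T ≡ M
  s+f = trans (any-count Q? xs T) (sym (length-vectors xs T))
  1≤M : 1 ≤ M
  1≤M = begin
    1              ≡⟨ ^-zeroˡ T ⟨
    1 ^ T          ≤⟨ ^-monoˡ-≤ T (≤-trans 1≤q (≤-trans (m≤m+n q b) (≤-reflexive q+b))) ⟩
    length xs ^ T  ≡⟨ length-vectors xs T ⟨
    M              ∎

1≤#permutations : ∀ n → 1 ≤ #permutations n
1≤#permutations n = begin
  1
    ≤⟨ ∈⇒≤∑ {f = λ _ → 1} (∈-permutations⁺ {n} (VecUnique.tabulate⁺ {f = id} id)) ⟩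
  ∑[ _ ← permutations n ] 1  ≡⟨ ∑-1 (permutations n) ⟩
  #permutations n            ∎
  where open ≤-Reasoning

length-seeds : ∀ n → length (seeds n) ≡ 2 ^ n * #permutations n
length-seeds n = trans (length-cartesianProductWith _,_ (assignments n) (permutations n))
                       (cong (_* #permutations n) (length-vectors _ n))

1≤#good : (F : CNF n) → Satisfiable F → 1 ≤ length (filter (good? F) (seeds n))
1≤#good {n} F (z , z⊨F) = begin
  1                                    ≤⟨ 1≤#permutations n ⟩
  #permutations n                      ≤⟨ #permutations≤weight F z ⟩
  weight F z                           ≤⟨ ∈⇒≤∑ {x = z} (∈-Ω⁺ z⊨F) ⟩
  ∑ (Ω F) (weight F)                   ≤⟨ ∑-weight-≤ F ⟩
  length (filter (good? F) (seeds n))  ∎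
  where open ≤-Reasoning

-- Number of iterations

*-^ : ∀ m o k → (m * o) ^ k ≡ m ^ k * o ^ k
*-^ m o zero    = refl
*-^ m o (suc k) = trans (cong (m * o *_) (*-^ m o k)) ([m*n]*[o*p]≡[m*o]*[n*p] m o (m ^ k) (o ^ k))

-- The exponent `e` will be `n / k ∸ 1`. It falls short of the exact `n/k` by at most 2, which costs
-- a factor 4; with the 2 in the hypothesis this makes the constant 8.
iterationBound : ∀ k {n e N T} .{{_ : NonZero k}} → n ≤ k * (2 + e) → T * N * 2 ^ e ≤ 2 * n * 2 ^ n →
  IterationBound k 8 1 n N T
iterationBound k {n} {e} {N} {T} n≤ TN≤ = *-cancelʳ-≤ _ _ (2 ^ (e * k)) {{m^n≢0 2 (e * k)}} (begin
  (T * N) ^ k * 2 ^ (e * k)                ≡⟨ cong ((T * N) ^ k *_) (^-*-assoc 2 e k) ⟨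
  (T * N) ^ k * (2 ^ e) ^ k                ≡⟨ *-^ (T * N) (2 ^ e) k ⟨
  (T * N * 2 ^ e) ^ k                      ≤⟨ ^-monoˡ-≤ k TN≤ ⟩
  (2 * n * 2 ^ n) ^ k                      ≡⟨ *-^ (2 * n) (2 ^ n) k ⟩
  (2 * n) ^ k * (2 ^ n) ^ k
    ≡⟨ cong ((2 * n) ^ k *_) (trans (^-*-assoc 2 n k) (cong (2 ^_) (*-comm n k))) ⟩
  -- A factor `2 ^ n` is split off from `2 ^ (k * n)` and bounded by `2 ^ ((2 + e) * k)`, whose part
  -- `2 ^ (e * k)` cancels.
  (2 * n) ^ k * 2 ^ (k * n)                ≡⟨ cong (λ x → (2 * n) ^ k * 2 ^ x) (m∸n+n≡m (m≤n*m n k)) ⟨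
  (2 * n) ^ k * 2 ^ (D + n)                ≡⟨ cong ((2 * n) ^ k *_) (^-distribˡ-+-* 2 D n) ⟩
  (2 * n) ^ k * (2 ^ D * 2 ^ n)
    ≤⟨ *-monoʳ-≤ ((2 * n) ^ k) (*-monoʳ-≤ (2 ^ D)
         (^-monoʳ-≤ 2 (≤-trans n≤ (≤-reflexive (*-comm k (2 + e)))))) ⟩
  (2 * n) ^ k * (2 ^ D * 2 ^ ((2 + e) * k))
    ≡⟨ cong (λ x → (2 * n) ^ k * (2 ^ D * x)) (^-*-assoc 2 (2 + e) k) ⟨
  (2 * n) ^ k * (2 ^ D * (2 ^ (2 + e)) ^ k)
    ≡⟨ cong (λ x → (2 * n) ^ k * (2 ^ D * x ^ k)) (^-distribˡ-+-* 2 2 e) ⟩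
  (2 * n) ^ k * (2 ^ D * (4 * 2 ^ e) ^ k)  ≡⟨ cong (λ x → (2 * n) ^ k * (2 ^ D * x)) (*-^ 4 (2 ^ e) k) ⟩
  (2 * n) ^ k * (2 ^ D * (4 ^ k * (2 ^ e) ^ k))
    ≡⟨ rearrange ((2 * n) ^ k) (2 ^ D) (4 ^ k) ((2 ^ e) ^ k) ⟩
  (4 ^ k * (2 * n) ^ k) * 2 ^ D * (2 ^ e) ^ k
    ≡⟨ cong₂ (λ x y → x * 2 ^ D * y) (sym (*-^ 4 (2 * n) k)) (^-*-assoc 2 e k) ⟩
  (4 * (2 * n)) ^ k * 2 ^ D * 2 ^ (e * k)  ≡⟨ cong (λ x → x ^ k * 2 ^ D * 2 ^ (e * k)) (constant n) ⟩
  (8 * n ^ 1) ^ k * 2 ^ D * 2 ^ (e * k)    ∎)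
  where
  open ≤-Reasoning
  D = k * n ∸ n
  rearrange : ∀ a d f x → a * (d * (f * x)) ≡ (f * a) * d * x
  rearrange = solve-∀
  constant : ∀ n → 4 * (2 * n) ≡ 8 * (n * 1)
  constant = solve-∀

m<[1+m/n]*n : ∀ m n .{{_ : NonZero n}} → m < suc (m / n) * n
m<[1+m/n]*n m n = begin-strict
  m                  ≡⟨ m≡m%n+[m/n]*n m n ⟩
  m % n + m / n * n  <⟨ +-monoˡ-< (m / n * n) (m%n<n m n) ⟩
  suc (m / n) * n    ∎
  where open ≤-Reasoning

ppz-succeeds : ∀ {k} .{{_ : NonZero k}} → 3 ≤ k → (F : CNF n) → IsKCNF k F → Satisfiable F →
  ∃[ T ] (IterationBound k 8 1 n (N F ((2 * n) / k)) T × 1ℚᵘ ℚᵘ.- ε n ℚᵘ.≤ successWithin F T)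
ppz-succeeds {n} {k} 3≤k F kcnf sat =
  T , iterationBound k {N = N₀} {T} n≤ (*-cancelʳ-≤ _ _ n! few) ,
  amplification (good? F) (seeds n) n T (1≤#good F sat) enough
  where
  open ≤-Reasoning
  #good = length (filter (good? F) (seeds n))
  L = length (seeds n)
  N₀ = N F ((2 * n) / k)
  n! = #permutations n
  e = n / k ∸ 1

  instance
    #good≢0 : NonZero #good
    #good≢0 = >-nonZero (1≤#good F sat)
    n!≢0 : NonZero n!
    n!≢0 = >-nonZero (1≤#permutations n)

  -- About `n / p` iterations, where `p = #good / L` is the success probability of one; the `suc`
  -- makes up for the floor of `1 / p`.
  T = n * suc (L / #good)

  enough : n * L ≤ T * #good
  enough = begin
    n * L                          ≤⟨ *-monoʳ-≤ n (<⇒≤ (m<[1+m/n]*n L #good)) ⟩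
    n * (suc (L / #good) * #good)  ≡⟨ *-assoc n (suc (L / #good)) #good ⟨
    T * #good                      ∎

  few : T * N₀ * 2 ^ e * n! ≤ 2 * n * 2 ^ n * n!
  few = begin
    T * N₀ * 2 ^ e * n!            ≡⟨ rearrange T N₀ (2 ^ e) n! ⟩
    T * (N₀ * (n! * 2 ^ e))        ≤⟨ *-monoʳ-≤ T (goodSeeds-≥ F 3≤k kcnf) ⟩
    T * #good                      ≡⟨ *-assoc n (suc (L / #good)) #good ⟩
    n * (#good + L / #good * #good)
      -- As `#good` is at most `L`, rounding up at most doubles the count, hence the factor 2.
      ≤⟨ *-monoʳ-≤ n (+-mono-≤ (List.length-filter (good? F) (seeds n)) (m/n*n≤m L #good)) ⟩
    n * (L + L)                    ≡⟨ cong (λ l → n * (l + l)) (length-seeds n) ⟩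
    n * (2 ^ n * n! + 2 ^ n * n!)  ≡⟨ collect n (2 ^ n) n! ⟩
    2 * n * 2 ^ n * n!             ∎
    where
    rearrange : ∀ t N x n! → t * N * x * n! ≡ t * (N * (n! * x))
    rearrange = solve-∀
    collect : ∀ n x n! → n * (x * n! + x * n!) ≡ 2 * n * x * n!
    collect = solve-∀

  n≤ : n ≤ k * (2 + e)
  n≤ = begin
    n                ≤⟨ <⇒≤ (m<[1+m/n]*n n k) ⟩
    suc (n / k) * k  ≡⟨ *-comm (suc (n / k)) k ⟩
    k * suc (n / k)  ≤⟨ *-monoʳ-≤ k (s≤s (m≤n+m∸n (n / k) 1)) ⟩
    k * (2 + e)      ∎

theorem39 : ∀ (k : ℕ) .{{_ : NonZero k}} → 3 ≤ k →
    Σ[ c ∈ ℕ ] Σ[ d ∈ ℕ ] Σ[ ε ∈ (ℕ → ℚᵘ) ]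
    (TendsToZero ε ×
    (∀ (n : ℕ) (F : CNF n) → IsKCNF k F → Satisfiable F →
    ∃[ T ] (IterationBound k c d n (N F ((2 * n) / k)) T ×
    (1ℚᵘ ℚᵘ.- ε n) ℚᵘ.≤ successWithin F T)))
-- The constants are uniform in `k`. The linear factor is the price of `n` expected successes, which
-- bring the failure probability down to `1 / (n + 1)`.
theorem39 k 3≤k = 8 , 1 , ε , ε-tendsToZero , λ n F → ppz-succeeds 3≤k F
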